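{- Let $n\ge 2$ be a fixed integer. Then, as $k\to\infty$, $$s_k^{\mathtt{HC}}(n)=2^{1/k}\sqrt{k}\,(1+o_k(1)).$$
   Context: $|x-y|$ denotes Euclidean distance. A Hamiltonian cycle $H$ through an $n$-element set $X$, $n\ge 2$, is a cyclic ordering $x_1,\ldots,x_n$ of all points of $X$, with edges $x_ix_{i+1}$, $i=1,\ldots,n$, where $x_{n+1}:=x_1$ (so for $n=2$ the single segment is counted twice). Let $s_k(H)=\left(\sum_{i=1}^n|x_i-x_{i+1}|^k\right)^{1/k}$. For finite $X\subseteq[0,1]^k$, $s_k^{\mathtt{HC}}(X)$ is the minimum of $s_k(H)$ over all Hamiltonian cycles $H$ through $X$, and $s_k^{\mathtt{HC}}(n)=\sup\{s_k^{\mathtt{HC}}(X):X\subseteq[0,1]^k,\ |X|=n\}$. The notation $o_k(1)$ denotes a quantity tending to $0$ as $k\to\infty$ (with $n$ held fixed). -}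

module Defs where

open import Level using (Level; _⊔_) renaming (suc to lsuc)
open import Algebra.Bundles using (CommutativeRing)
open import Data.Nat.Base as ℕ using (ℕ; zero; suc; NonZero)
import Data.Nat.Properties as ℕ
open import Data.Nat.DivMod using (_mod_)
open import Data.Fin.Base using (Fin; zero; suc; toℕ; punchIn)
import Data.Fin.Properties as Fin
open import Data.Fin.Permutation as Perm using (Permutation′; _⟨$⟩ʳ_)
open import Data.List.Base using (List; []; _∷_; cartesianProductWith; allFin)
open import Data.List.Membership.Propositional using (_∈_)
open import Data.List.Membership.Propositional.Properties
  using (∈-cartesianProductWith⁺; ∈-allFin)
open import Data.List.Relation.Unary.All as All using ()
open import Data.List.Relation.Unary.Any using (here; there)
import Data.List.Extrema as Extrema
open import Data.Product using (Σ; ∃; ∃-syntax; _×_; _,_; proj₁; proj₂)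
open import Data.Sum using (_⊎_; inj₁; inj₂)
open import Data.Vec.Functional using (Vector)
open import Relation.Binary.Core using (Rel)
open import Relation.Binary.Bundles using (TotalOrder; Poset)
open import Relation.Binary.Definitions using (tri<; tri≈; tri>)
open import Relation.Binary.Structures using (IsDecTotalOrder)
import Relation.Binary.Reasoning.PartialOrder as ≤-Reasoning
open import Relation.Binary.PropositionalEquality as ≡ using (_≡_)
open import Relation.Nullary using (¬_; yes; no; contradiction)

-- The real numbers, as a classical Dedekind-complete ordered field (up to
-- isomorphism there is exactly one).  Order is decidable and suprema exist for
-- arbitrary predicates: existence of a model is a theorem of classical logic,
-- not of Agda alone, so the field is a parameter of everything below.
record CompleteOrderedField (c ℓ : Level) : Set (lsuc (c ⊔ ℓ)) where
  infix 4 _≤_ _<_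
  field
    commutativeRing : CommutativeRing c ℓ

  open CommutativeRing commutativeRing public hiding (zero)

  field
    0≉1             : 0# ≉ 1#
    inverse         : ∀ x → x ≉ 0# → ∃[ y ] x * y ≈ 1#
    _≤_             : Rel Carrier ℓ
    isDecTotalOrder : IsDecTotalOrder _≈_ _≤_
    +-monoˡ-≤       : ∀ z {x y} → x ≤ y → x + z ≤ y + z
    *-nonNegative   : ∀ {x y} → 0# ≤ x → 0# ≤ y → 0# ≤ x * y

  IsUpperBound : (Carrier → Set (c ⊔ ℓ)) → Carrier → Set (c ⊔ ℓ)
  IsUpperBound P b = ∀ x → P x → x ≤ b

  IsSupremum : (Carrier → Set (c ⊔ ℓ)) → Carrier → Set (c ⊔ ℓ)
  IsSupremum P s = IsUpperBound P s × (∀ b → IsUpperBound P b → s ≤ b)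

  field
    supremum : ∀ P → ∃ P → ∃ (IsUpperBound P) → ∃ (IsSupremum P)

  _<_ : Rel Carrier ℓ
  x < y = x ≤ y × x ≉ y

module OrderedFieldProperties {c ℓ : Level} (R : CompleteOrderedField c ℓ) where
  open CompleteOrderedField R public
  open IsDecTotalOrder isDecTotalOrder public
    using (_≟_; _≤?_; total; antisym; isTotalOrder; isPartialOrder)
    renaming (refl to ≤-refl; trans to ≤-trans; reflexive to ≤-reflexive;
              ≤-respˡ-≈ to ≤-respˡ; ≤-respʳ-≈ to ≤-respʳ)

  open import Algebra.Properties.Semiring.Exp semiring public
    using (_^_; ^-congˡ)
  open import Algebra.Definitions.RawMonoid +-rawMonoid public
    using (sum) renaming (_×_ to _·_)
  open import Algebra.Properties.Ring ring public
    using (-‿distribˡ-*; -‿distribʳ-*; -‿involutive; -0#≈0#; -‿anti-homo-+)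
  import Algebra.Solver.Ring.NaturalCoefficients.Default
    commutativeSemiring as Solver
  open Solver using (_:=_; _:+_; _:*_; con)

  totalOrder : TotalOrder c ℓ ℓ
  totalOrder = record { isTotalOrder = isTotalOrder }

  poset : Poset c ℓ ℓ
  poset = record { isPartialOrder = isPartialOrder }

  open ≤-Reasoning poset

  fromNat : ℕ → Carrier
  fromNat n = n · 1#

  ≰⇒≥ : ∀ {x y} → ¬ (x ≤ y) → y ≤ x
  ≰⇒≥ {x} {y} x≰y with total x y
  ... | inj₁ x≤y = contradiction x≤y x≰y
  ... | inj₂ y≤x = y≤x

  +-monoʳ-≤ : ∀ z {x y} → x ≤ y → z + x ≤ z + y
  +-monoʳ-≤ z {x} {y} x≤y = begin
    z + x  ≈⟨ +-comm z x ⟩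
    x + z  ≤⟨ +-monoˡ-≤ z x≤y ⟩
    y + z  ≈⟨ +-comm y z ⟩
    z + y  ∎

  +-mono-≤ : ∀ {x y u v} → x ≤ y → u ≤ v → x + u ≤ y + v
  +-mono-≤ x≤y u≤v = ≤-trans (+-monoˡ-≤ _ x≤y) (+-monoʳ-≤ _ u≤v)

  x+z-z : ∀ x z → (x + z) - z ≈ x
  x+z-z x z = trans (+-assoc x z (- z))
    (trans (+-congˡ (-‿inverseʳ z)) (+-identityʳ x))

  x-z+z : ∀ x z → (x - z) + z ≈ x
  x-z+z x z = trans (+-assoc x (- z) z)
    (trans (+-congˡ (-‿inverseˡ z)) (+-identityʳ x))

  +-cancelʳ-≤ : ∀ z {x y} → x + z ≤ y + z → x ≤ y
  +-cancelʳ-≤ z {x} {y} p = begin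
    x            ≈⟨ x+z-z x z ⟨
    (x + z) - z  ≤⟨ +-monoˡ-≤ (- z) p ⟩
    (y + z) - z  ≈⟨ x+z-z y z ⟩
    y            ∎

  0≤-⇒≤ : ∀ {x y} → 0# ≤ y - x → x ≤ y
  0≤-⇒≤ {x} {y} p = begin
    x            ≈⟨ +-identityˡ x ⟨
    0# + x       ≤⟨ +-monoˡ-≤ x p ⟩
    (y - x) + x  ≈⟨ x-z+z y x ⟩
    y            ∎

  ≤⇒0≤- : ∀ {x y} → x ≤ y → 0# ≤ y - x
  ≤⇒0≤- {x} {y} p = ≤-respˡ (-‿inverseʳ x) (+-monoˡ-≤ (- x) p)

  0≤⇒x≤x+y : ∀ x {y} → 0# ≤ y → x ≤ x + y
  0≤⇒x≤x+y x p = ≤-respˡ (+-identityʳ x) (+-monoʳ-≤ x p)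

  0≤⇒x≤y+x : ∀ x {y} → 0# ≤ y → x ≤ y + x
  0≤⇒x≤y+x x p = ≤-respˡ (+-identityˡ x) (+-monoˡ-≤ x p)

  +-nonNegative : ∀ {x y} → 0# ≤ x → 0# ≤ y → 0# ≤ x + y
  +-nonNegative p q = ≤-trans p (0≤⇒x≤x+y _ q)

  *-monoˡ-≤ : ∀ {z} → 0# ≤ z → ∀ {x y} → x ≤ y → x * z ≤ y * z
  *-monoˡ-≤ {z} 0≤z {x} {y} x≤y = 0≤-⇒≤ (begin
    0#                   ≤⟨ *-nonNegative (≤⇒0≤- x≤y) 0≤z ⟩
    (y - x) * z          ≈⟨ distribʳ z y (- x) ⟩
    y * z + (- x) * z    ≈⟨ +-congˡ (-‿distribˡ-* x z) ⟨
    y * z - x * z        ∎)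

  *-monoʳ-≤ : ∀ {z} → 0# ≤ z → ∀ {x y} → x ≤ y → z * x ≤ z * y
  *-monoʳ-≤ {z} 0≤z {x} {y} p = begin
    z * x  ≈⟨ *-comm z x ⟩
    x * z  ≤⟨ *-monoˡ-≤ 0≤z p ⟩
    y * z  ≈⟨ *-comm y z ⟩
    z * y  ∎

  0≤x*x : ∀ x → 0# ≤ x * x
  0≤x*x x with total 0# x
  ... | inj₁ 0≤x = *-nonNegative 0≤x 0≤x
  ... | inj₂ x≤0 = begin
    0#             ≤⟨ *-nonNegative 0≤-x 0≤-x ⟩
    - x * - x      ≈⟨ -‿distribˡ-* x (- x) ⟨
    - (x * - x)    ≈⟨ -‿cong (-‿distribʳ-* x x) ⟨
    - - (x * x)    ≈⟨ -‿involutive (x * x) ⟩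
    x * x          ∎
    where
    0≤-x : 0# ≤ - x
    0≤-x = ≤-respʳ (+-identityˡ (- x)) (≤⇒0≤- x≤0)

  0≤1 : 0# ≤ 1#
  0≤1 = ≤-respʳ (*-identityˡ 1#) (0≤x*x 1#)

  1≰0 : ¬ (1# ≤ 0#)
  1≰0 p = 0≉1 (antisym 0≤1 p)

  0<1 : 0# < 1#
  0<1 = 0≤1 , 0≉1

  0≤^ : ∀ n {x} → 0# ≤ x → 0# ≤ x ^ n
  0≤^ zero    p = 0≤1
  0≤^ (suc n) p = *-nonNegative p (0≤^ n p)

  1≤^ : ∀ n {x} → 1# ≤ x → 1# ≤ x ^ n
  1≤^ zero    p = ≤-refl
  1≤^ (suc n) {x} p = begin
    1#         ≤⟨ p ⟩
    x          ≈⟨ *-identityʳ x ⟨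
    x * 1#     ≤⟨ *-monoʳ-≤ (≤-trans 0≤1 p) (1≤^ n p) ⟩
    x * x ^ n  ∎

  ^-mono-≤ : ∀ n {x y} → 0# ≤ x → x ≤ y → x ^ n ≤ y ^ n
  ^-mono-≤ zero    0≤x x≤y = ≤-refl
  ^-mono-≤ (suc n) {x} {y} 0≤x x≤y = begin
    x * x ^ n  ≤⟨ *-monoˡ-≤ (0≤^ n 0≤x) x≤y ⟩
    y * x ^ n  ≤⟨ *-monoʳ-≤ (≤-trans 0≤x x≤y) (^-mono-≤ n 0≤x x≤y) ⟩
    y * y ^ n  ∎

  0≤fromNat : ∀ n → 0# ≤ fromNat n
  0≤fromNat zero    = ≤-refl
  0≤fromNat (suc n) = +-nonNegative 0≤1 (0≤fromNat n)

  fromNat-mono-≤ : ∀ {m n} → m ℕ.≤ n → fromNat m ≤ fromNat n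
  fromNat-mono-≤ {n = n} ℕ.z≤n = 0≤fromNat n
  fromNat-mono-≤ (ℕ.s≤s m≤n)   = +-monoʳ-≤ 1# (fromNat-mono-≤ m≤n)

  fromNat-cancel-< : ∀ {m n} → m ℕ.< n → ¬ (fromNat n ≤ fromNat m)
  fromNat-cancel-< {m} {n} m<n p = 1≰0 (+-cancelʳ-≤ (fromNat m) (begin
    1# + fromNat m  ≤⟨ fromNat-mono-≤ m<n ⟩
    fromNat n       ≤⟨ p ⟩
    fromNat m       ≈⟨ +-identityˡ (fromNat m) ⟨
    0# + fromNat m  ∎))

  fromNat-injective : ∀ {m n} → fromNat m ≈ fromNat n → m ≡ n
  fromNat-injective {m} {n} eq with ℕ.<-cmp m n
  ... | tri< m<n _ _ = contradiction (≤-reflexive (sym eq)) (fromNat-cancel-< m<n)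
  ... | tri≈ _ m≡n _ = m≡n
  ... | tri> _ _ n<m = contradiction (≤-reflexive eq) (fromNat-cancel-< n<m)

  0≤inverse : ∀ {x y} → 0# ≤ x → x * y ≈ 1# → 0# ≤ y
  0≤inverse {x} {y} 0≤x xy≈1 with total 0# y
  ... | inj₁ 0≤y = 0≤y
  ... | inj₂ y≤0 = contradiction (begin
    1#      ≈⟨ xy≈1 ⟨
    x * y   ≤⟨ *-monoʳ-≤ 0≤x y≤0 ⟩
    x * 0#  ≈⟨ zeroʳ x ⟩
    0#      ∎) 1≰0

  sum-mono-≤ : ∀ {n} (f g : Vector Carrier n) → (∀ i → f i ≤ g i) → sum f ≤ sum g
  sum-mono-≤ {zero}  f g p = ≤-refl
  sum-mono-≤ {suc n} f g p =
    +-mono-≤ (p zero) (sum-mono-≤ (λ i → f (suc i)) (λ i → g (suc i)) (λ i → p (suc i)))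

  0≤sum : ∀ {n} (f : Vector Carrier n) → (∀ i → 0# ≤ f i) → 0# ≤ sum f
  0≤sum {zero}  f p = ≤-refl
  0≤sum {suc n} f p = +-nonNegative (p zero) (0≤sum (λ i → f (suc i)) (λ i → p (suc i)))

  -- For 0 ≤ t ≤ s the slope of x ↦ xⁿ on [t , t + 1] is at most `slope n s`.
  slope : ℕ → Carrier → Carrier
  slope zero    s = 0#
  slope (suc n) s = s ^ n + (s + 1#) * slope n s

  0≤slope : ∀ n {s} → 0# ≤ s → 0# ≤ slope n s
  0≤slope zero    0≤s = ≤-refl
  0≤slope (suc n) 0≤s =
    +-nonNegative (0≤^ n 0≤s) (*-nonNegative (+-nonNegative 0≤s 0≤1) (0≤slope n 0≤s))

  ^-lipschitz : ∀ n {s t δ} → 0# ≤ t → t ≤ s → 0# ≤ δ → δ ≤ 1# →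
                (t + δ) ^ n ≤ t ^ n + δ * slope n s
  ^-lipschitz zero    {δ = δ} _ _ _ _ =
    ≤-reflexive (trans (sym (+-identityʳ 1#)) (+-congˡ (sym (zeroʳ δ))))
  ^-lipschitz (suc n) {s} {t} {δ} 0≤t t≤s 0≤δ δ≤1 = begin
    (t + δ) * (t + δ) ^ n
      ≤⟨ *-monoʳ-≤ (+-nonNegative 0≤t 0≤δ) (^-lipschitz n 0≤t t≤s 0≤δ δ≤1) ⟩
    (t + δ) * (t ^ n + δ * slope n s)
      ≈⟨ Solver.solve 4 (λ t δ p C →
           (t :+ δ) :* (p :+ δ :* C) := t :* p :+ δ :* (p :+ (t :+ δ) :* C))
           refl t δ (t ^ n) (slope n s) ⟩
    t * t ^ n + δ * (t ^ n + (t + δ) * slope n s)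
      ≤⟨ +-monoʳ-≤ _ (*-monoʳ-≤ 0≤δ (+-mono-≤ (^-mono-≤ n 0≤t t≤s)
           (*-monoˡ-≤ (0≤slope n (≤-trans 0≤t t≤s)) (+-mono-≤ t≤s δ≤1)))) ⟩
    t * t ^ n + δ * (s ^ n + (s + 1#) * slope n s) ∎

  ≤-by-approximation : ∀ {a b C} → 0# ≤ C →
    (∀ δ → 0# < δ → δ ≤ 1# → a ≤ b + δ * C) → a ≤ b
  ≤-by-approximation {a} {b} {C} 0≤C approx with a ≤? b
  ... | yes a≤b = a≤b
  ... | no  a≰b = contradiction d≤0 d≰0
    where
    d D : Carrier
    d = a - b
    D = d + (C + 1#)

    0≤d : 0# ≤ d
    0≤d = ≤⇒0≤- (≰⇒≥ a≰b)

    d≰0 : ¬ (d ≤ 0#)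
    d≰0 p = a≰b (begin
      a            ≈⟨ x-z+z a b ⟨
      (a - b) + b  ≤⟨ +-monoˡ-≤ b p ⟩
      0# + b       ≈⟨ +-identityˡ b ⟩
      b            ∎)

    1≤D : 1# ≤ D
    1≤D = ≤-trans (0≤⇒x≤y+x 1# 0≤C) (0≤⇒x≤y+x _ 0≤d)

    0≤D : 0# ≤ D
    0≤D = ≤-trans 0≤1 1≤D

    u : Carrier
    u = proj₁ (inverse D (λ D≈0 → 1≰0 (≤-respʳ D≈0 1≤D)))

    Du≈1 : D * u ≈ 1#
    Du≈1 = proj₂ (inverse D (λ D≈0 → 1≰0 (≤-respʳ D≈0 1≤D)))

    0≤u : 0# ≤ u
    0≤u = 0≤inverse 0≤D Du≈1

    δ : Carrier
    δ = d * u

    δD≈d : D * δ ≈ d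
    δD≈d = begin-equality
      D * (d * u)  ≈⟨ Solver.solve 3 (λ D d u → D :* (d :* u) := d :* (D :* u)) refl D d u ⟩
      d * (D * u)  ≈⟨ *-congˡ Du≈1 ⟩
      d * 1#       ≈⟨ *-identityʳ d ⟩
      d            ∎

    0<δ : 0# < δ
    0<δ = *-nonNegative 0≤d 0≤u , λ 0≈δ → d≰0 (begin
      d       ≈⟨ δD≈d ⟨
      D * δ   ≈⟨ *-congˡ 0≈δ ⟨
      D * 0#  ≈⟨ zeroʳ D ⟩
      0#      ∎)

    δ≤1 : δ ≤ 1#
    δ≤1 = begin
      d * u  ≤⟨ *-monoˡ-≤ 0≤u (0≤⇒x≤x+y d (+-nonNegative 0≤C 0≤1)) ⟩
      D * u  ≈⟨ Du≈1 ⟩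
      1#     ∎

    d≤δC : d ≤ δ * C
    d≤δC = +-cancelʳ-≤ b (begin
      d + b      ≈⟨ x-z+z a b ⟩
      a          ≤⟨ approx δ 0<δ δ≤1 ⟩
      b + δ * C  ≈⟨ +-comm b (δ * C) ⟩
      δ * C + b  ∎)

    d≤0 : d ≤ 0#
    d≤0 = +-cancelʳ-≤ (C * d) (begin
      d + C * d               ≤⟨ 0≤⇒x≤y+x _ (0≤x*x d) ⟩
      d * d + (d + C * d)     ≈⟨ Solver.solve 2 (λ d C →
                                   d :* d :+ (d :+ C :* d) := (d :+ (C :+ con 1)) :* d)
                                   refl d C ⟩
      D * d                   ≤⟨ *-monoʳ-≤ 0≤D d≤δC ⟩
      D * (δ * C)             ≈⟨ *-assoc D δ C ⟨
      (D * δ) * C             ≈⟨ *-congʳ δD≈d ⟩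
      d * C                   ≈⟨ *-comm d C ⟩
      C * d                   ≈⟨ +-identityˡ (C * d) ⟨
      0# + C * d              ∎)

  ^≤⇒≤1+ : ∀ k .{{_ : NonZero k}} {x y} → 0# ≤ x → y ^ k ≤ x → y ≤ 1# + x
  ^≤⇒≤1+ (suc k) {x} {y} 0≤x yᵏ≤x with total y 1#
  ... | inj₁ y≤1 = ≤-trans y≤1 (0≤⇒x≤x+y 1# 0≤x)
  ... | inj₂ 1≤y = begin
    y          ≈⟨ *-identityʳ y ⟨
    y * 1#     ≤⟨ *-monoʳ-≤ (≤-trans 0≤1 1≤y) (1≤^ k 1≤y) ⟩
    y * y ^ k  ≤⟨ yᵏ≤x ⟩
    x          ≤⟨ 0≤⇒x≤y+x x 0≤1 ⟩
    1# + x     ∎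

  root-exists : ∀ k .{{_ : NonZero k}} {x} → 0# ≤ x → ∃[ r ] 0# ≤ r × r ^ k ≈ x
  root-exists k@(suc k-1) {x} 0≤x = s , 0≤s , antisym sᵏ≤x x≤sᵏ
    where
    P : Carrier → Set (c ⊔ ℓ)
    P y = Σ Carrier λ z → z ≈ y × 0# ≤ z × z ^ k ≤ x

    P-intro : ∀ {y} → 0# ≤ y → y ^ k ≤ x → P y
    P-intro {y} p q = y , refl , p , q

    P-inhabited : ∃ P
    P-inhabited = 0# , P-intro ≤-refl (≤-respˡ (sym (zeroˡ (0# ^ k-1))) 0≤x)

    P-bounded : ∃ (IsUpperBound P)
    P-bounded = 1# + x , λ { y (z , z≈y , _ , zᵏ≤x) → ≤-respˡ z≈y (^≤⇒≤1+ k 0≤x zᵏ≤x) }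

    s : Carrier
    s = proj₁ (supremum P P-inhabited P-bounded)

    s-upper : IsUpperBound P s
    s-upper = proj₁ (proj₂ (supremum P P-inhabited P-bounded))

    s-least : ∀ b → IsUpperBound P b → s ≤ b
    s-least = proj₂ (proj₂ (supremum P P-inhabited P-bounded))

    0≤s : 0# ≤ s
    0≤s = s-upper 0# (proj₂ P-inhabited)

    C : Carrier
    C = slope k s

    0≤C : 0# ≤ C
    0≤C = 0≤slope k 0≤s

    s+δ≰s : ∀ {δ} → 0# < δ → ¬ (s + δ ≤ s)
    s+δ≰s {δ} (0≤δ , 0≉δ) p = 0≉δ (antisym 0≤δ (+-cancelʳ-≤ s (begin
      δ + s   ≈⟨ +-comm δ s ⟩
      s + δ   ≤⟨ p ⟩
      s       ≈⟨ +-identityˡ s ⟨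
      0# + s  ∎)))

    x≤sᵏ : x ≤ s ^ k
    x≤sᵏ = ≤-by-approximation 0≤C λ δ 0<δ δ≤1 → case-x δ 0<δ δ≤1
      where
      case-x : ∀ δ → 0# < δ → δ ≤ 1# → x ≤ s ^ k + δ * C
      case-x δ 0<δ δ≤1 with total x (s ^ k + δ * C)
      ... | inj₁ p = p
      ... | inj₂ p = contradiction
        (s-upper (s + δ) (P-intro (+-nonNegative 0≤s (proj₁ 0<δ))
          (≤-trans (^-lipschitz k 0≤s ≤-refl (proj₁ 0<δ) δ≤1) p)))
        (s+δ≰s 0<δ)

    sᵏ≤x : s ^ k ≤ x
    sᵏ≤x = ≤-by-approximation 0≤C λ δ 0<δ δ≤1 → case-s δ 0<δ δ≤1
      where
      case-s : ∀ δ → 0# < δ → δ ≤ 1# → s ^ k ≤ x + δ * C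
      case-s δ 0<δ δ≤1 with s ^ k ≤? x + δ * C
      ... | yes p = p
      ... | no ¬p = contradiction s+δ≤s (s+δ≰s 0<δ)
        where
        upper : IsUpperBound P (s - δ)
        upper y py@(z , z≈y , 0≤z , zᵏ≤x) with total y (s - δ)
        ... | inj₁ q = q
        ... | inj₂ q = contradiction (begin
          s ^ k            ≤⟨ ^-mono-≤ k 0≤s s≤z+δ ⟩
          (z + δ) ^ k      ≤⟨ ^-lipschitz k 0≤z (≤-respˡ (sym z≈y) (s-upper y py))
                                (proj₁ 0<δ) δ≤1 ⟩
          z ^ k + δ * C    ≤⟨ +-monoˡ-≤ _ zᵏ≤x ⟩
          x + δ * C        ∎) ¬p
          where
          s≤z+δ : s ≤ z + δ
          s≤z+δ = begin
            s            ≈⟨ x-z+z s δ ⟨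
            (s - δ) + δ  ≤⟨ +-monoˡ-≤ δ q ⟩
            y + δ        ≈⟨ +-congʳ z≈y ⟨
            z + δ        ∎

        s+δ≤s : s + δ ≤ s
        s+δ≤s = begin
          s + δ        ≤⟨ +-monoˡ-≤ δ (s-least (s - δ) upper) ⟩
          (s - δ) + δ  ≈⟨ x-z+z s δ ⟩
          s            ∎

  -- The nonnegative k-th root; the value 0 on negative arguments is never used.
  root : (k : ℕ) .{{_ : NonZero k}} → Carrier → Carrier
  root k x with 0# ≤? x
  ... | yes 0≤x = proj₁ (root-exists k 0≤x)
  ... | no  _   = 0#

  root-spec : ∀ k .{{_ : NonZero k}} {x} → 0# ≤ x → 0# ≤ root k x × root k x ^ k ≈ x
  root-spec k {x} 0≤x with 0# ≤? x
  ... | yes p = proj₂ (root-exists k p)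
  ... | no ¬p = contradiction 0≤x ¬p

  root≤1+ : ∀ k .{{_ : NonZero k}} {x} → 0# ≤ x → root k x ≤ 1# + x
  root≤1+ k 0≤x = ^≤⇒≤1+ k 0≤x (≤-reflexive (proj₂ (root-spec k 0≤x)))

  sqrt : Carrier → Carrier
  sqrt = root 2

  TendsToZero : (ℕ → Carrier) → Set (c ⊔ ℓ)
  TendsToZero e = ∀ ε → 0# < ε → ∃[ N ] ∀ m → N ℕ.≤ m → - ε < e m × e m < ε

permutations : ∀ n → List (Permutation′ n)
permutations zero    = Perm.id ∷ []
permutations (suc n) =
  cartesianProductWith (Perm.insert zero) (allFin (suc n)) (permutations n)

permutations-complete : ∀ n (π : Permutation′ n) →
                        ∃[ ρ ] ρ ∈ permutations n × (∀ i → ρ ⟨$⟩ʳ i ≡ π ⟨$⟩ʳ i)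
permutations-complete zero    π = Perm.id , here ≡.refl , λ ()
permutations-complete (suc n) π with permutations-complete n (Perm.remove zero π)
... | ρ , ρ∈ , ρ≈ =
  Perm.insert zero (π ⟨$⟩ʳ zero) ρ ,
  ∈-cartesianProductWith⁺ (Perm.insert zero) (∈-allFin (π ⟨$⟩ʳ zero)) ρ∈ ,
  agree
  where
  agree : ∀ i → Perm.insert zero (π ⟨$⟩ʳ zero) ρ ⟨$⟩ʳ i ≡ π ⟨$⟩ʳ i
  agree zero    = ≡.refl
  agree (suc i) = ≡.trans (Perm.insert-punchIn zero (π ⟨$⟩ʳ zero) ρ i)
    (≡.trans (≡.cong (punchIn (π ⟨$⟩ʳ zero)) (ρ≈ i))
             (≡.sym (Perm.punchIn-permute π zero i)))

-- Cyclic successor: 0 ↦ 1 ↦ ⋯ ↦ n - 1 ↦ 0.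
next : ∀ {n} → Fin n → Fin n
next {suc n} i = suc (toℕ i) mod suc n

module HamiltonianCycles {c ℓ : Level} (R : CompleteOrderedField c ℓ) where
  open OrderedFieldProperties R
  open ≤-Reasoning poset

  Point : ℕ → Set c
  Point k = Vector Carrier k

  distance : ∀ {k} → Point k → Point k → Carrier
  distance x y = sqrt (sum (λ j → (x j - y j) ^ 2))

  -- An n-element subset of [0,1]ᵏ, given by an enumeration without repetition.
  record PointSet (n k : ℕ) : Set (c ⊔ ℓ) where
    field
      point    : Fin n → Point k
      distinct : ∀ a b → (∀ j → point a j ≈ point b j) → a ≡ b
      inCube   : ∀ a j → 0# ≤ point a j × point a j ≤ 1#

  open PointSet public

  -- The cycle H visits point X (H 0), point X (H 1), …, point X (H (n - 1)) in
  -- this order and returns to its start.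
  HamiltonianCycle : ℕ → Set
  HamiltonianCycle n = Permutation′ n

  edge : ∀ {n k} → PointSet n k → HamiltonianCycle n → Fin n → Carrier
  edge X H i = distance (point X (H ⟨$⟩ʳ i)) (point X (H ⟨$⟩ʳ next i))

  cycleSum : ∀ {n k} → PointSet n k → HamiltonianCycle n → Carrier
  cycleSum {k = k} X H = sum (λ i → edge X H i ^ k)

  -- s_k(H)
  sCycle : ∀ {n k} .{{_ : NonZero k}} → PointSet n k → HamiltonianCycle n → Carrier
  sCycle {k = k} X H = root k (cycleSum X H)

  sum-cong-≡ : ∀ {n} (f g : Vector Carrier n) → (∀ i → f i ≡ g i) → sum f ≡ sum g
  sum-cong-≡ {zero}  f g p = ≡.refl
  sum-cong-≡ {suc n} f g p =
    ≡.cong₂ _+_ (p zero) (sum-cong-≡ (λ i → f (suc i)) (λ i → g (suc i)) (λ i → p (suc i)))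

  sCycle-cong : ∀ {n k} .{{_ : NonZero k}} (X : PointSet n k) {H K : HamiltonianCycle n} →
                (∀ i → H ⟨$⟩ʳ i ≡ K ⟨$⟩ʳ i) → sCycle X H ≡ sCycle X K
  sCycle-cong {k = k} X {H} {K} H≈K = ≡.cong (root k)
    (sum-cong-≡ (λ i → edge X H i ^ k) (λ i → edge X K i ^ k) λ i →
      ≡.cong₂ (λ a b → distance (point X a) (point X b) ^ k) (H≈K i) (H≈K (next i)))

  shortest-exists : ∀ {n k} .{{_ : NonZero k}} (X : PointSet n k) →
                    ∃[ H ] ∀ K → sCycle X H ≤ sCycle X K
  shortest-exists {n} X = H , minimal
    where
    open Extrema totalOrder using (argmin; f[argmin]≤f[xs])

    H : HamiltonianCycle n
    H = argmin (sCycle X) Perm.id (permutations n)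

    minimal : ∀ K → sCycle X H ≤ sCycle X K
    minimal K with permutations-complete n K
    ... | ρ , ρ∈ , ρ≈K = ≡.subst (sCycle X H ≤_) (sCycle-cong X {ρ} {K} ρ≈K)
      (All.lookup (f[argmin]≤f[xs] Perm.id (permutations n)) ρ∈)

  -- s_k^HC(X), a minimum over all Hamiltonian cycles.
  sHCof : ∀ {n k} .{{_ : NonZero k}} → PointSet n k → Carrier
  sHCof X = sCycle X (proj₁ (shortest-exists X))

  sHCof-minimum : ∀ {n k} .{{_ : NonZero k}} (X : PointSet n k) →
                  (∃[ H ] sHCof X ≡ sCycle X H) × (∀ H → sHCof X ≤ sCycle X H)
  sHCof-minimum X =
    (proj₁ (shortest-exists X) , ≡.refl) , proj₂ (shortest-exists X)

  ValueOf-sHC : ∀ n k .{{_ : NonZero k}} → Carrier → Set (c ⊔ ℓ)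
  ValueOf-sHC n k v = Σ (PointSet n k) λ X → v ≈ sHCof X

  pointSet : ∀ n k .{{_ : NonZero k}} → PointSet n k
  pointSet n k = record
    { point    = λ a _ → inv a
    ; distinct = λ a b eq → distinct′ k a b eq
    ; inCube   = λ a _ → 0≤inverse (0≤fromNat (suc (toℕ a))) (inv-spec a) , inv≤1 a
    }
    where
    denominator : Fin n → Carrier
    denominator a = fromNat (suc (toℕ a))

    1≤denominator : ∀ a → 1# ≤ denominator a
    1≤denominator a = 0≤⇒x≤x+y 1# (0≤fromNat (toℕ a))

    nonZero : ∀ a → denominator a ≉ 0#
    nonZero a d≈0 = 1≰0 (≤-respʳ d≈0 (1≤denominator a))

    inv : Fin n → Carrier
    inv a = proj₁ (inverse (denominator a) (nonZero a))

    inv-spec : ∀ a → denominator a * inv a ≈ 1#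
    inv-spec a = proj₂ (inverse (denominator a) (nonZero a))

    inv≤1 : ∀ a → inv a ≤ 1#
    inv≤1 a = begin
      inv a                  ≈⟨ *-identityˡ (inv a) ⟨
      1# * inv a             ≤⟨ *-monoˡ-≤ (0≤inverse (0≤fromNat (suc (toℕ a))) (inv-spec a))
                                  (1≤denominator a) ⟩
      denominator a * inv a  ≈⟨ inv-spec a ⟩
      1#                     ∎

    denominators-agree : ∀ a b → inv a ≈ inv b → denominator a ≈ denominator b
    denominators-agree a b eq = begin-equality
      denominator a                            ≈⟨ *-identityʳ _ ⟨
      denominator a * 1#                       ≈⟨ *-congˡ (inv-spec b) ⟨
      denominator a * (denominator b * inv b)  ≈⟨ *-congˡ (*-comm _ _) ⟩
      denominator a * (inv b * denominator b)  ≈⟨ *-assoc _ _ _ ⟨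
      (denominator a * inv b) * denominator b  ≈⟨ *-congʳ (*-congˡ eq) ⟨
      (denominator a * inv a) * denominator b  ≈⟨ *-congʳ (inv-spec a) ⟩
      1# * denominator b                       ≈⟨ *-identityˡ _ ⟩
      denominator b                            ∎

    distinct′ : ∀ k .{{_ : NonZero k}} (a b : Fin n) →
                ((j : Fin k) → inv a ≈ inv b) → a ≡ b
    distinct′ (suc _) a b eq = Fin.toℕ-injective
      (ℕ.suc-injective (fromNat-injective (denominators-agree a b (eq zero))))

  square≤1 : ∀ {x y} → 0# ≤ x × x ≤ 1# → 0# ≤ y × y ≤ 1# → (x - y) ^ 2 ≤ 1#
  square≤1 {x} {y} (0≤x , x≤1) (0≤y , y≤1) with total 0# (x - y)
  ... | inj₁ 0≤d = begin
    (x - y) ^ 2  ≤⟨ ^-mono-≤ 2 0≤d x-y≤1 ⟩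
    1# ^ 2       ≈⟨ trans (*-identityˡ _) (*-identityˡ _) ⟩
    1#           ∎
    where
    x-y≤1 : x - y ≤ 1#
    x-y≤1 = +-cancelʳ-≤ y (≤-respˡ (sym (x-z+z x y)) (≤-trans x≤1 (0≤⇒x≤x+y 1# 0≤y)))
  ... | inj₂ d≤0 = begin
    (x - y) * ((x - y) * 1#)          ≈⟨ *-congˡ (*-identityʳ _) ⟩
    (x - y) * (x - y)                 ≈⟨ -‿involutive _ ⟨
    - - ((x - y) * (x - y))           ≈⟨ -‿cong (-‿distribʳ-* _ _) ⟩
    - ((x - y) * - (x - y))           ≈⟨ -‿distribˡ-* _ _ ⟩
    - (x - y) * - (x - y)             ≈⟨ *-cong neg neg ⟩
    (y - x) * (y - x)                 ≈⟨ *-congˡ (*-identityʳ _) ⟨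
    (y - x) ^ 2                       ≤⟨ ^-mono-≤ 2 (≤⇒0≤- x≤y) y-x≤1 ⟩
    1# ^ 2                            ≈⟨ trans (*-identityˡ _) (*-identityˡ _) ⟩
    1#                                ∎
    where
    neg : - (x - y) ≈ y - x
    neg = trans (-‿anti-homo-+ x (- y)) (+-congʳ (-‿involutive y))

    x≤y : x ≤ y
    x≤y = ≤-respˡ (x-z+z x y) (≤-respʳ (+-identityˡ y) (+-monoˡ-≤ y d≤0))

    y-x≤1 : y - x ≤ 1#
    y-x≤1 = +-cancelʳ-≤ x (≤-respˡ (sym (x-z+z y x)) (≤-trans y≤1 (0≤⇒x≤x+y 1# 0≤x)))

  sum-const : ∀ n x → sum {n} (λ _ → x) ≈ n · x
  sum-const zero    x = refl
  sum-const (suc n) x = +-congˡ (sum-const n x)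

  0≤^2 : ∀ x → 0# ≤ x ^ 2
  0≤^2 x = ≤-respʳ (*-congˡ (sym (*-identityʳ x))) (0≤x*x x)

  0≤distance : ∀ {k} (x y : Point k) → 0# ≤ distance x y
  0≤distance x y = proj₁ (root-spec 2 (0≤sum (λ j → (x j - y j) ^ 2) (λ j → 0≤^2 (x j - y j))))

  0≤edge : ∀ {n k} (X : PointSet n k) H i → 0# ≤ edge X H i
  0≤edge X H i = 0≤distance (point X (H ⟨$⟩ʳ i)) (point X (H ⟨$⟩ʳ next i))

  0≤cycleSum : ∀ {n k} (X : PointSet n k) H → 0# ≤ cycleSum X H
  0≤cycleSum {k = k} X H = 0≤sum (λ i → edge X H i ^ k) (λ i → 0≤^ k (0≤edge X H i))

  values-bounded : ∀ n k .{{_ : NonZero k}} → ∃ (IsUpperBound (ValueOf-sHC n k))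
  values-bounded n k = 1# + n · (D ^ k) , bound
    where
    D : Carrier
    D = 1# + fromNat k

    δ² : PointSet n k → Fin n → Fin n → Vector Carrier k
    δ² X a b j = (point X a j - point X b j) ^ 2

    distance≤D : (X : PointSet n k) → ∀ a b → distance (point X a) (point X b) ≤ D
    distance≤D X a b = begin
      distance (point X a) (point X b)
        ≤⟨ root≤1+ 2 (0≤sum (δ² X a b) (λ j → 0≤^2 (point X a j - point X b j))) ⟩
      1# + sum (λ j → (point X a j - point X b j) ^ 2)
        ≤⟨ +-monoʳ-≤ 1# (sum-mono-≤ (δ² X a b) (λ _ → 1#)
             (λ j → square≤1 (inCube X a j) (inCube X b j))) ⟩
      1# + sum {k} (λ _ → 1#)
        ≈⟨ +-congˡ (sum-const k 1#) ⟩
      1# + fromNat k ∎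

    bound : IsUpperBound (ValueOf-sHC n k) (1# + n · (D ^ k))
    bound v (X , v≈) = begin
      v                         ≈⟨ v≈ ⟩
      root k (cycleSum X H)     ≤⟨ root≤1+ k (0≤cycleSum X H) ⟩
      1# + cycleSum X H         ≤⟨ +-monoʳ-≤ 1# (sum-mono-≤ (λ i → edge X H i ^ k) (λ _ → D ^ k)
                                     (λ i → ^-mono-≤ k (0≤edge X H i)
                                       (distance≤D X (H ⟨$⟩ʳ i) (H ⟨$⟩ʳ next i)))) ⟩
      1# + sum {n} (λ _ → D ^ k) ≈⟨ +-congˡ (sum-const n (D ^ k)) ⟩
      1# + n · (D ^ k)          ∎
      where
      H : HamiltonianCycle n
      H = proj₁ (shortest-exists X)

  sHC-exists : ∀ n k .{{_ : NonZero k}} → ∃ (IsSupremum (ValueOf-sHC n k))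
  sHC-exists n k = supremum (ValueOf-sHC n k)
    (sHCof (pointSet n k) , pointSet n k , refl) (values-bounded n k)

  -- s_k^HC(n)
  sHC : (n k : ℕ) .{{_ : NonZero k}} → Carrier
  sHC n k = proj₁ (sHC-exists n k)

  sHC-supremum : ∀ n k .{{_ : NonZero k}} → IsSupremum (ValueOf-sHC n k) (sHC n k)
  sHC-supremum n k = proj₂ (sHC-exists n k)

{-# OPTIONS --safe #-}

-- Two edges meet at each point, so one point at the corner (1,…,1) and n - 1 points clustered
-- at the origin give s_k^HC(n) ≥ 2^{1/k} √k for every k.  For k ≥ 8n + 2 this is an equality,
-- and the error is 0.  (Equality, not just a limit, is what is needed: without the
-- Archimedean property, which does not follow constructively from the field axioms, the
-- threshold for k has to be independent of ε.)
--
-- For the upper bound call an edge short if its squared length is at most 2k/3.  Three points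
-- of the cube always span a short edge, as (x - y)² + (y - z)² + (x - z)² ≤ 2 on [0,1].  Hence
-- either there is a Hamiltonian path of short edges, closed by one arbitrary edge, or the
-- points split into two parts with only long edges between them.  In the second case close the
-- tour by the longest crossing edge, of squared length k - D: all squared distances inside
-- the parts are then at most 2D, and the saving D on this edge pays for all inner edges.

module Submission where

open import Defs
open import Level using (Level; _⊔_)
import Algebra.Properties.CommutativeMonoid.Sum as Sum
import Algebra.Properties.CommutativeSemiring.Exp as Exp
import Algebra.Properties.Semiring.Mult as Mult
import Algebra.Solver.Ring.NaturalCoefficients.Default as RingSolver
open import Data.Fin.Base using (Fin; zero; suc; toℕ; fromℕ; inject₁; punchIn; punchOut)
open import Data.Fin.Permutation as Perm using (Permutation′; permutation; _⟨$⟩ʳ_; _⟨$⟩ˡ_)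
import Data.Fin.Properties as Fin
open import Data.Fin.Relation.Unary.Top using (view; ‵fromℕ; ‵inj₁)
open import Data.List.Base
  using (List; []; _∷_; _++_; [_]; length; lookup; tabulate; allFin; cartesianProduct)
import Data.List.Extrema as Extrema
open import Data.List.Membership.Propositional using (_∈_; find)
open import Data.List.Membership.Propositional.Properties
  using (∈-∃++; ∈-allFin; ∈-tabulate⁺; ∈-tabulate⁻; ∈-cartesianProduct⁺; ∈-cartesianProduct⁻)
open import Data.List.Properties using (++-assoc; length-++; length-tabulate; tabulate-lookup)
open import Data.List.Relation.Binary.Permutation.Propositional
  using (_↭_; prep; ↭-refl; ↭-sym; ↭-trans; ↭-reflexive; ↭⇒↭ₛ)
open import Data.List.Relation.Binary.Permutation.Propositional.Properties
  using (shift; ++-comm; ++⁺; ++⁺ˡ; ∈-resp-↭; ↭-length)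
import Data.List.Relation.Binary.Permutation.Setoid.Properties as Permutationₛ
open import Data.List.Relation.Unary.All as All using (all?)
open import Data.List.Relation.Unary.All.Properties using (¬All⇒Any¬)
open import Data.List.Relation.Unary.AllPairs using ([]; _∷_)
open import Data.List.Relation.Unary.Any as Any using (here; there; any?)
open import Data.List.Relation.Unary.Linked using (Linked; []; [-]; _∷_)
open import Data.List.Relation.Unary.Unique.Propositional using (Unique)
open import Data.List.Relation.Unary.Unique.Propositional.Properties using (allFin⁺)
open import Data.Nat.Base as ℕ using (ℕ; zero; suc; NonZero) renaming (_≤_ to _≤ℕ_)
open import Data.Nat.DivMod using (_%_; m<n⇒m%n≡m; n%n≡0)
import Data.Nat.Properties as ℕ
open import Data.Product using (Σ; ∃-syntax; _×_; _,_; proj₁; proj₂)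
open import Data.Sum using (_⊎_; inj₁; inj₂)
open import Relation.Binary.Core using (Rel)
open import Relation.Binary.Definitions using (Decidable; Symmetric)
open import Relation.Binary.PropositionalEquality as ≡ using (_≡_; _≢_)
import Relation.Binary.Reasoning.PartialOrder as ≤-Reasoning
open import Relation.Nullary using (¬_; Dec; yes; no; contradiction)

private variable
  a ℓ : Level
  A : Set a

-- Paths as nonempty lists: concatenation, splitting and rotation.

end : A → List A → A
end x []       = x
end x (y ∷ ys) = end y ys

end-++ : ∀ (x : A) xs {y ys} → end x (xs ++ y ∷ ys) ≡ end y ys
end-++ x []       = ≡.refl
end-++ x (z ∷ xs) = end-++ z xs

module _ {R : Rel A ℓ} where

  linked-++ : ∀ {x xs y ys} → Linked R (x ∷ xs) → R (end x xs) y →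
              Linked R (y ∷ ys) → Linked R (x ∷ xs ++ y ∷ ys)
  linked-++ {xs = []}    [-]     r q = r ∷ q
  linked-++ {xs = _ ∷ _} (l ∷ p) r q = l ∷ linked-++ p r q

  linked-split : ∀ {x} xs {y ys} → Linked R (x ∷ xs ++ y ∷ ys) →
                 Linked R (x ∷ xs) × Linked R (y ∷ ys)
  linked-split []       (_ ∷ q) = [-] , q
  linked-split (_ ∷ xs) (l ∷ p) with linked-split xs p
  ... | p₁ , p₂ = l ∷ p₁ , p₂

  clique-linked : ∀ xs → (∀ {u v} → u ∈ xs → v ∈ xs → R u v) → Linked R xs
  clique-linked []           _ = []
  clique-linked (_ ∷ [])     _ = [-]
  clique-linked (_ ∷ y ∷ xs) r =
    r (here ≡.refl) (there (here ≡.refl)) ∷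
    clique-linked (y ∷ xs) (λ u∈ v∈ → r (there u∈) (there v∈))

  -- The relation between the two ends closes the path into a cycle, which can be cut open just
  -- before any chosen vertex `y`.
  rotate : ∀ {x xs y} → Linked R (x ∷ xs) → R (end x xs) x → y ∈ x ∷ xs →
           ∃[ ys ] y ∷ ys ↭ x ∷ xs × Linked R (y ∷ ys)
  rotate {x} {xs} {y} p r y∈ with ∈-∃++ y∈
  ... | []     , zs , ≡.refl = zs , ↭-refl , p
  ... | _ ∷ ys , zs , ≡.refl with linked-split ys p
  ...   | p₁ , p₂ =
    zs ++ x ∷ ys , ++-comm (y ∷ zs) (x ∷ ys) ,
    linked-++ p₂ (≡.subst (λ z → R z x) (end-++ x ys) r) p₁

∈⇒↭-head : ∀ {x y : A} {xs} → y ∈ x ∷ xs → ∃[ ys ] y ∷ ys ↭ x ∷ xs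
∈⇒↭-head y∈ with ∈-∃++ y∈
... | ys , zs , eq = ys ++ zs , ↭-trans (↭-sym (shift _ ys zs)) (↭-reflexive (≡.sym eq))

-- Graphs without three pairwise non-adjacent vertices.

module Arrangements {A : Set a} (_∼_ : Rel A ℓ) (_∼?_ : Decidable _∼_)
  (∼-sym : Symmetric _∼_) (no-independent-triple : ∀ x y z → x ∼ y ⊎ y ∼ z ⊎ x ∼ z)
  where

  -- `separated` records only that no edge crosses. That both parts are complete graphs follows by
  -- `clique`, so any ordering of either part is a path.
  data Arrangement (vs : List A) : Set (a ⊔ ℓ) where
    path      : ∀ {x xs} → x ∷ xs ↭ vs → Linked _∼_ (x ∷ xs) → Arrangement vs
    separated : ∀ {x xs y ys} → (x ∷ xs) ++ (y ∷ ys) ↭ vs →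
                (∀ {u v} → u ∈ x ∷ xs → v ∈ y ∷ ys → ¬ u ∼ v) → Arrangement vs

  -- Two vertices that both miss `y` would form an independent triple with it. Since triples may
  -- repeat a vertex, this also covers `u` equal to `v`.
  clique : ∀ {xs y} → (∀ {u} → u ∈ xs → ¬ u ∼ y) → ∀ {u v} → u ∈ xs → v ∈ xs → u ∼ v
  clique {y = y} sep {u} {v} u∈ v∈ with no-independent-triple u v y
  ... | inj₁ u∼v        = u∼v
  ... | inj₂ (inj₁ v∼y) = contradiction v∼y (sep v∈)
  ... | inj₂ (inj₂ u∼y) = contradiction u∼y (sep u∈)

  -- If `v` misses the second part, it joins the first. Otherwise it is a bridge: traverse the first
  -- clique, step to `v`, then to a neighbour `u` in the second clique, and traverse the rest of
  -- that clique.
  attach : ∀ {x xs y ys vs} v → (x ∷ xs) ++ (y ∷ ys) ↭ vs →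
           (∀ {u w} → u ∈ x ∷ xs → w ∈ y ∷ ys → ¬ u ∼ w) →
           (∀ {u} → u ∈ x ∷ xs → u ∼ v) → Arrangement (v ∷ vs)
  attach {x} {xs} {y} {ys} v p sep joined with any? (v ∼?_) (y ∷ ys)
  ... | no  v≁ys = separated {x = v} (prep v p) λ
        { (here ≡.refl) w∈ v∼w → v≁ys (Any.map (λ { ≡.refl → v∼w }) w∈)
        ; (there u∈)    w∈     → sep u∈ w∈ }
  ... | yes v∼ys with find v∼ys
  ...   | u , u∈ , v∼u with ∈⇒↭-head u∈
  ...     | zs , u∷zs↭ = path
    (↭-trans (shift v (x ∷ xs) (u ∷ zs)) (prep v (↭-trans (++⁺ˡ (x ∷ xs) u∷zs↭) p)))
    (linked-++
      (clique-linked (x ∷ xs) (clique (λ w∈ → sep w∈ (here ≡.refl))))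
      (joined (end-∈ x xs))
      (v∼u ∷ clique-linked (u ∷ zs) λ w∈ w′∈ →
        clique (λ w∈ w∼x → sep (here ≡.refl) w∈ (∼-sym w∼x))
          (∈-resp-↭ u∷zs↭ w∈) (∈-resp-↭ u∷zs↭ w′∈)))
    where
    end-∈ : ∀ x xs → end x xs ∈ x ∷ xs
    end-∈ x []       = here ≡.refl
    end-∈ x (y ∷ ys) = there (end-∈ y ys)

  -- A vertex adjacent to neither end of a path forces the two ends to be adjacent. The path then
  -- closes into a cycle, which is reopened at a neighbour of `v`; if `v` has no neighbour on it,
  -- `v` alone is one of two separated parts.
  insert : ∀ {vs} v → Arrangement vs → Arrangement (v ∷ vs)
  insert v (path {x} {xs} p l) with v ∼? x | end x xs ∼? v | any? (v ∼?_) (x ∷ xs)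
  ... | yes v∼x | _       | _    = path (prep v p) (v∼x ∷ l)
  ... | no  _   | yes e∼v | _    =
    path (↭-trans (++-comm (x ∷ xs) [ v ]) (prep v p)) (linked-++ l e∼v [-])
  ... | no  _   | no  _   | no v≁xs = separated {xs = []} (prep v p) λ
    { (here ≡.refl) u∈ v∼u → v≁xs (Any.map (λ { ≡.refl → v∼u }) u∈) }
  ... | no  v≁x | no e≁v  | yes v∼xs with no-independent-triple (end x xs) x v | find v∼xs
  ...   | inj₂ (inj₁ x∼v) | _ = contradiction (∼-sym x∼v) v≁x
  ...   | inj₂ (inj₂ e∼v) | _ = contradiction e∼v e≁v
  ...   | inj₁ e∼x | u , u∈ , v∼u with rotate l e∼x u∈
  ...     | zs , u∷zs↭ , l′ = path (prep v (↭-trans u∷zs↭ p)) (v∼u ∷ l′)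
  insert v (separated {x} {xs} {y} {ys} p sep) with all? (_∼? v) (x ∷ xs)
  ... | yes joined = attach v p sep (All.lookup joined)
  ... | no ¬joined with find (¬All⇒Any¬ (_∼? v) _ ¬joined)
  -- The vertex `u` misses `v` and the whole second part, so every vertex of the second part is
  -- adjacent to `v`. The two parts exchange roles.
  ...   | u , u∈ , u≁v = attach v (↭-trans (++-comm (y ∷ ys) (x ∷ xs)) p)
    (λ w∈ w′∈ w∼w′ → sep w′∈ w∈ (∼-sym w∼w′)) joined
    where
    joined : ∀ {w} → w ∈ y ∷ ys → w ∼ v
    joined {w} w∈ with no-independent-triple u w v
    ... | inj₁ u∼w        = contradiction u∼w (sep u∈ w∈)
    ... | inj₂ (inj₁ w∼v) = w∼v
    ... | inj₂ (inj₂ u∼v) = contradiction u∼v u≁v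

  arrange : ∀ v vs → Arrangement (v ∷ vs)
  arrange v []       = path ↭-refl [-]
  arrange v (u ∷ vs) = insert v (arrange u vs)

-- From rearranged lists to permutations, and the cyclic successor.

tabulate-injective : ∀ {n} {f : Fin n → A} → Unique (tabulate f) →
                     ∀ i j → f i ≡ f j → i ≡ j
tabulate-injective (_ ∷ _) zero    zero    _  = ≡.refl
tabulate-injective (p ∷ _) zero    (suc j) eq =
  contradiction eq (All.lookup p (∈-tabulate⁺ j))
tabulate-injective (p ∷ _) (suc i) zero    eq =
  contradiction (≡.sym eq) (All.lookup p (∈-tabulate⁺ i))
tabulate-injective (_ ∷ u) (suc i) (suc j) eq = ≡.cong suc (tabulate-injective u i j eq)

-- Being a rearrangement of `allFin n` gives surjectivity through membership and injectivity through
-- uniqueness, so a choice of preimages is a two-sided inverse.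
↭allFin⇒permutation : ∀ {n} (f : Fin n → Fin n) → tabulate f ↭ allFin n →
                      Σ (Permutation′ n) λ π → ∀ i → π ⟨$⟩ʳ i ≡ f i
↭allFin⇒permutation {n} f p =
  permutation f index f∘index
    (λ i → tabulate-injective unique (index (f i)) i (f∘index (f i))) ,
  λ _ → ≡.refl
  where
  preimage : ∀ i → ∃[ j ] i ≡ f j
  preimage i = ∈-tabulate⁻ (∈-resp-↭ (↭-sym p) (∈-allFin i))

  index : Fin n → Fin n
  index i = proj₁ (preimage i)

  f∘index : ∀ i → f (index i) ≡ i
  f∘index i = ≡.sym (proj₂ (preimage i))

  unique : Unique (tabulate f)
  unique = Permutationₛ.Unique-resp-↭ (≡.setoid _) (↭⇒↭ₛ (↭-sym p)) (allFin⁺ n)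

as-tabulate : ∀ {n} (xs : List A) → length xs ≡ n → ∃[ f ] tabulate {n = n} f ≡ xs
as-tabulate xs ≡.refl = lookup xs , tabulate-lookup xs

next-inject₁ : ∀ {m} (j : Fin m) → next (inject₁ j) ≡ suc j
next-inject₁ {m} j = Fin.toℕ-injective (≡.trans (Fin.toℕ-fromℕ< _)
  (≡.trans (≡.cong (λ x → suc x % suc m) (Fin.toℕ-inject₁ j))
    (m<n⇒m%n≡m (ℕ.s≤s (Fin.toℕ<n j)))))

next-fromℕ : ∀ m → next (fromℕ m) ≡ zero
next-fromℕ m = Fin.toℕ-injective (≡.trans (Fin.toℕ-fromℕ< _)
  (≡.trans (≡.cong (λ x → suc x % suc m) (Fin.toℕ-fromℕ m)) (n%n≡0 (suc m))))

prev : ∀ {m} → Fin (suc m) → Fin (suc m)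
prev {m} zero = fromℕ m
prev (suc j)  = inject₁ j

next-prev : ∀ {m} (i : Fin (suc m)) → next (prev i) ≡ i
next-prev {m} zero = next-fromℕ m
next-prev (suc j)  = next-inject₁ j

-- At least two positions are assumed because on a single one the cyclic successor is the identity.
-- The top position wraps to `zero`, every other one moves up by one.
next≢id : ∀ {m} (i : Fin (suc (suc m))) → next i ≢ i
next≢id i eq with view i
... | ‵fromℕ   = contradiction (≡.trans (≡.sym (next-fromℕ _)) eq) λ ()
... | ‵inj₁ {i = j} _ = ℕ.1+n≢n (≡.trans (≡.cong toℕ (≡.trans (≡.sym (next-inject₁ j)) eq))
                                  (Fin.toℕ-inject₁ j))

-- Costs of tours written as lists.

module Costs {c ℓ : Level} (ℝ : CompleteOrderedField c ℓ) where
  open OrderedFieldProperties ℝ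
  open Sum +-commutativeMonoid using (sum-init-last; sum-remove)
  open ≤-Reasoning poset

  module _ (w : A → A → Carrier) where

    cost : A → List A → Carrier
    cost x []       = 0#
    cost x (y ∷ ys) = w x y + cost y ys

    tourCost : A → List A → Carrier
    tourCost x xs = cost x xs + w (end x xs) x

    cost-++ : ∀ x xs y ys → cost x (xs ++ y ∷ ys) ≈ cost x xs + (w (end x xs) y + cost y ys)
    cost-++ x []       y ys = sym (+-identityˡ _)
    cost-++ x (z ∷ xs) y ys = trans (+-congˡ (cost-++ z xs y ys)) (sym (+-assoc _ _ _))

    -- The factor `N` replaces a division: each edge is allotted one `N`-th of `b`. With at most `N`
    -- edges the total is at most `b` once `N` is cancelled.
    cost-≤ : ∀ {r N b} {R : Rel A r} → (∀ {x y} → R x y → N * w x y ≤ b) →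
             ∀ {x xs} → Linked R (x ∷ xs) → N * cost x xs ≤ fromNat (length xs) * b
    cost-≤ {N = N} bound [-] = ≤-reflexive (trans (zeroʳ N) (sym (zeroˡ _)))
    cost-≤ {N = N} {b} bound {x} {y ∷ ys} (l ∷ p) = begin
      N * (w x y + cost y ys)            ≈⟨ distribˡ N _ _ ⟩
      N * w x y + N * cost y ys          ≤⟨ +-mono-≤ (bound l) (cost-≤ bound p) ⟩
      b + fromNat (length ys) * b        ≈⟨ +-congʳ (*-identityˡ b) ⟨
      1# * b + fromNat (length ys) * b   ≈⟨ distribʳ b _ _ ⟨
      (1# + fromNat (length ys)) * b     ∎

    sum-path : ∀ {m} (v : Fin (suc m) → A) →
               sum (λ j → w (v (inject₁ j)) (v (suc j))) ≡
                 cost (v zero) (tabulate (λ j → v (suc j))) ×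
               end (v zero) (tabulate (λ j → v (suc j))) ≡ v (fromℕ m)
    sum-path {zero}  v = ≡.refl , ≡.refl
    sum-path {suc m} v with sum-path (λ j → v (suc j))
    ... | costs , ends = ≡.cong (w _ _ +_) costs , ends

    -- The last position is split off because only there does `next` wrap around; it yields the
    -- closing edge of the tour.
    sum-cycle : ∀ {m} (v : Fin (suc m) → A) →
                sum (λ i → w (v i) (v (next i))) ≈
                tourCost (v zero) (tabulate (λ j → v (suc j)))
    sum-cycle {m} v = begin-equality
      sum f                                    ≈⟨ sum-init-last f ⟩
      sum (λ j → f (inject₁ j)) + f (fromℕ m)
        ≈⟨ +-cong (Sum.sum-cong-≋ +-commutativeMonoid
             (λ j → reflexive (≡.cong (λ i → w (v (inject₁ j)) (v i)) (next-inject₁ j))))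
             (reflexive (≡.cong (λ i → w (v (fromℕ m)) (v i)) (next-fromℕ m))) ⟩
      sum (λ j → w (v (inject₁ j)) (v (suc j))) + w (v (fromℕ m)) (v zero)
        ≡⟨ ≡.cong₂ (λ s e → s + w e (v zero)) (proj₁ (sum-path v)) (≡.sym (proj₂ (sum-path v))) ⟩
      tourCost (v zero) (tabulate (λ j → v (suc j))) ∎
      where
      f : Fin (suc m) → Carrier
      f i = w (v i) (v (next i))

  cycle-from-list : ∀ {n} (x : Fin n) xs → x ∷ xs ↭ allFin n →
                    Σ (Permutation′ n) λ H → ∀ (w : Fin n → Fin n → Carrier) →
                    sum (λ i → w (H ⟨$⟩ʳ i) (H ⟨$⟩ʳ next i)) ≈ tourCost w x xs
  cycle-from-list {suc m} x xs p
    with as-tabulate (x ∷ xs) (≡.trans (↭-length p) (length-tabulate {n = suc m} (λ i → i)))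
  ... | f , ≡.refl with ↭allFin⇒permutation f p
  ...   | H , H≡ = H , λ w → trans
    (reflexive (HamiltonianCycles.sum-cong-≡ ℝ _ _
      (λ i → ≡.cong₂ w (H≡ i) (H≡ (next i)))))
    (sum-cycle w f)

  two-terms≤sum : ∀ {n} (f : Fin n → Carrier) → (∀ i → 0# ≤ f i) →
                  ∀ {i j} → i ≢ j → f i + f j ≤ sum f
  two-terms≤sum {suc n} f 0≤f {i} {j} i≢j = begin
    f i + f j                     ≤⟨ +-monoʳ-≤ (f i) (begin
      f j                          ≡⟨ ≡.cong f (Fin.punchIn-punchOut i≢j) ⟨
      g (punchOut i≢j)             ≤⟨ term≤sum g (λ l → 0≤f (punchIn i l)) (punchOut i≢j) ⟩
      sum g                        ∎) ⟩
    f i + sum g                   ≈⟨ sum-remove f ⟨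
    sum f                         ∎
    where
    g : Fin n → Carrier
    g l = f (punchIn i l)

    term≤sum : ∀ {n} (f : Fin n → Carrier) → (∀ i → 0# ≤ f i) → ∀ i → f i ≤ sum f
    term≤sum {suc n} f 0≤f zero = begin
      f zero       ≤⟨ 0≤⇒x≤x+y (f zero) (0≤sum (λ i → f (suc i)) (λ i → 0≤f (suc i))) ⟩
      f zero + sum (λ i → f (suc i)) ∎
    term≤sum {suc n} f 0≤f (suc i) = begin
      f (suc i)                       ≤⟨ term≤sum (λ i → f (suc i)) (λ i → 0≤f (suc i)) i ⟩
      sum (λ i → f (suc i))           ≤⟨ 0≤⇒x≤y+x _ (0≤f zero) ⟩
      f zero + sum (λ i → f (suc i))  ∎

-- Inequalities for squares and powers.

module Inequalities {c ℓ : Level} (ℝ : CompleteOrderedField c ℓ) where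
  open OrderedFieldProperties ℝ
  open Exp commutativeSemiring using (^-distrib-*; ^-homo-*; ^-assocʳ)
  open RingSolver commutativeSemiring using (solve; _:=_; _:+_; _:*_; con)
  open ≤-Reasoning poset

  two : Carrier
  two = 1# + 1#

  +-cancel-double-≤ : ∀ {x y} → x + x ≤ y + y → x ≤ y
  +-cancel-double-≤ {x} {y} p with total x y
  ... | inj₁ x≤y = x≤y
  ... | inj₂ y≤x = +-cancelʳ-≤ x (≤-trans p (+-monoʳ-≤ y y≤x))

  *-cancelʳ-≤ : ∀ {x y z} → 0# ≤ z → z ≉ 0# → x * z ≤ y * z → x ≤ y
  *-cancelʳ-≤ {x} {y} {z} 0≤z z≉0 p with inverse z z≉0
  ... | u , zu≈1 = begin
    x            ≈⟨ x*z*u≈x x ⟨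
    (x * z) * u  ≤⟨ *-monoˡ-≤ (0≤inverse 0≤z zu≈1) p ⟩
    (y * z) * u  ≈⟨ x*z*u≈x y ⟩
    y            ∎
    where
    x*z*u≈x : ∀ x → (x * z) * u ≈ x
    x*z*u≈x x = trans (*-assoc x z u) (trans (*-congˡ zu≈1) (*-identityʳ x))

  *-cancelˡ-≤ : ∀ {x y z} → 0# ≤ z → z ≉ 0# → z * x ≤ z * y → x ≤ y
  *-cancelˡ-≤ {x} {y} {z} 0≤z z≉0 p =
    *-cancelʳ-≤ 0≤z z≉0 (≤-respˡ (*-comm z x) (≤-respʳ (*-comm z y) p))

  *-≉0 : ∀ {x y} → x ≉ 0# → y ≉ 0# → x * y ≉ 0#
  *-≉0 {x} {y} x≉0 y≉0 xy≈0 with inverse x x≉0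
  ... | u , xu≈1 = y≉0 (begin-equality
    y            ≈⟨ *-identityˡ y ⟨
    1# * y       ≈⟨ *-congʳ xu≈1 ⟨
    (x * u) * y  ≈⟨ solve 3 (λ x u y → (x :* u) :* y := u :* (x :* y)) refl x u y ⟩
    u * (x * y)  ≈⟨ *-congˡ xy≈0 ⟩
    u * 0#       ≈⟨ zeroʳ u ⟩
    0#           ∎)

  ^-≉0 : ∀ k {x} → x ≉ 0# → x ^ k ≉ 0#
  ^-≉0 zero    x≉0 1≈0 = 0≉1 (sym 1≈0)
  ^-≉0 (suc k) x≉0     = *-≉0 x≉0 (^-≉0 k x≉0)

  0^k≈0 : ∀ k .{{_ : NonZero k}} → 0# ^ k ≈ 0#
  0^k≈0 (suc k) = zeroˡ (0# ^ k)

  ^-cancel-≤ : ∀ k .{{_ : NonZero k}} {x y} → 0# ≤ y → x ^ k ≤ y ^ k → x ≤ y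
  ^-cancel-≤ (suc k) {x} {y} 0≤y p with x ≤? y
  ... | yes x≤y = x≤y
  ... | no  x≰y = *-cancelʳ-≤ (0≤^ k 0≤x) (^-≉0 k x≉0) (begin
    x * x ^ k  ≤⟨ p ⟩
    y * y ^ k  ≤⟨ *-monoʳ-≤ 0≤y (^-mono-≤ k 0≤y y≤x) ⟩
    y * x ^ k  ∎)
    where
    y≤x : y ≤ x
    y≤x = ≰⇒≥ x≰y

    0≤x : 0# ≤ x
    0≤x = ≤-trans 0≤y y≤x

    x≉0 : x ≉ 0#
    x≉0 x≈0 = x≰y (≤-respˡ (sym x≈0) 0≤y)

  fromNat-≉0 : ∀ k .{{_ : NonZero k}} → fromNat k ≉ 0#
  fromNat-≉0 (suc k) k≈0 = 1≰0 (≤-respʳ k≈0 (0≤⇒x≤x+y 1# (0≤fromNat k)))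

  fromNat-2 : fromNat 2 ≈ two
  fromNat-2 = +-congˡ (+-identityʳ 1#)

  two* : ∀ x → two * x ≈ x + x
  two* = solve 1 (λ x → (con 1 :+ con 1) :* x := x :+ x) refl

  sum-const-* : ∀ n x → sum {n} (λ _ → x) ≈ fromNat n * x
  sum-const-* zero    x = sym (zeroˡ x)
  sum-const-* (suc n) x = trans (+-cong (sym (*-identityˡ x)) (sum-const-* n x))
    (sym (distribʳ x 1# (fromNat n)))

  -- The exponential growth that lets one high power absorb the number of edges.
  fromNat≤two^ : ∀ m → fromNat m ≤ two ^ m
  fromNat≤two^ zero    = 0≤1
  fromNat≤two^ (suc m) = begin
    1# + fromNat m        ≤⟨ +-mono-≤ (1≤^ m (0≤⇒x≤x+y 1# 0≤1)) (fromNat≤two^ m) ⟩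
    two ^ m + two ^ m     ≈⟨ two* (two ^ m) ⟨
    two * two ^ m         ∎

  fromNat-+ : ∀ m n → fromNat (m ℕ.+ n) ≈ fromNat m + fromNat n
  fromNat-+ = Mult.×-homo-+ semiring 1#

  -- The binomial formula with its negative term moved across: once `x` is written as `d + y`, it
  -- becomes an identity without subtraction, within reach of the semiring solver.
  square-sub : ∀ x y → (x - y) ^ 2 + (x * y + x * y) ≈ x * x + y * y
  square-sub x y = begin-equality
    d ^ 2 + (x * y + x * y)
      ≈⟨ +-congˡ (+-cong (*-congʳ x≈d+y) (*-congʳ x≈d+y)) ⟩
    d ^ 2 + ((d + y) * y + (d + y) * y)
      ≈⟨ solve 2 (λ d y → d :* (d :* con 1) :+ ((d :+ y) :* y :+ (d :+ y) :* y)
                    := (d :+ y) :* (d :+ y) :+ y :* y) refl d y ⟩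
    (d + y) * (d + y) + y * y
      ≈⟨ +-congʳ (*-cong x≈d+y x≈d+y) ⟨
    x * x + y * y ∎
    where
    d : Carrier
    d = x - y

    x≈d+y : x ≈ d + y
    x≈d+y = sym (x-z+z x y)

  square-sub-comm : ∀ x y → (x - y) ^ 2 ≈ (y - x) ^ 2
  square-sub-comm x y = antisym (half x y) (half y x)
    where
    half : ∀ x y → (x - y) ^ 2 ≤ (y - x) ^ 2
    half x y = +-cancelʳ-≤ (x * y + x * y) (begin
      (x - y) ^ 2 + (x * y + x * y)  ≈⟨ square-sub x y ⟩
      x * x + y * y                  ≈⟨ +-comm _ _ ⟩
      y * y + x * x                  ≈⟨ square-sub y x ⟨
      (y - x) ^ 2 + (y * x + y * x)  ≈⟨ +-congˡ (+-cong (*-comm y x) (*-comm y x)) ⟩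
      (y - x) ^ 2 + (x * y + x * y)  ∎)

  square≤id : ∀ {x} → 0# ≤ x → x ≤ 1# → x * x ≤ x
  square≤id {x} 0≤x x≤1 = ≤-respʳ (*-identityˡ x) (*-monoˡ-≤ 0≤x x≤1)

  -- With x′ = 1 - x etc., 1 + xy + yz + xz = x + y + z + xyz + x′y′z′.
  squares≤1+products : ∀ {x y z} → 0# ≤ x × x ≤ 1# → 0# ≤ y × y ≤ 1# → 0# ≤ z × z ≤ 1# →
                       x * x + y * y + z * z ≤ 1# + (x * y + y * z + x * z)
  squares≤1+products {x} {y} {z} (0≤x , x≤1) (0≤y , y≤1) (0≤z , z≤1) = begin
    x * x + y * y + z * z
      ≤⟨ +-mono-≤ (+-mono-≤ (square≤id 0≤x x≤1) (square≤id 0≤y y≤1)) (square≤id 0≤z z≤1) ⟩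
    x + y + z
      ≤⟨ 0≤⇒x≤x+y _ (+-nonNegative
           (*-nonNegative (*-nonNegative 0≤x 0≤y) 0≤z)
           (*-nonNegative (*-nonNegative (≤⇒0≤- x≤1) (≤⇒0≤- y≤1)) (≤⇒0≤- z≤1))) ⟩
    x + y + z + (x * y * z + x′ * y′ * z′)
      ≈⟨ +-congʳ (+-cong (+-cong (x≈x*1*1 x Y≈1 Z≈1) (x≈x*1*1 y X≈1 Z≈1)) (x≈x*1*1 z X≈1 Y≈1)) ⟩
    x * (Y * Z) + y * (X * Z) + z * (X * Y) + (x * y * z + x′ * y′ * z′)
      ≈⟨ solve 6 (λ x x′ y y′ z z′ →
           x :* ((y :+ y′) :* (z :+ z′)) :+ y :* ((x :+ x′) :* (z :+ z′))
             :+ z :* ((x :+ x′) :* (y :+ y′)) :+ (x :* y :* z :+ x′ :* y′ :* z′)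
           := (x :+ x′) :* ((y :+ y′) :* (z :+ z′))
             :+ ((x :* y) :* (z :+ z′) :+ (y :* z) :* (x :+ x′) :+ (x :* z) :* (y :+ y′)))
           refl x x′ y y′ z z′ ⟩
    X * (Y * Z) + (x * y * Z + y * z * X + x * z * Y)
      ≈⟨ +-cong (trans (sym (x≈x*1*1 X Y≈1 Z≈1)) X≈1)
           (+-cong (+-cong (x*1 Z≈1) (x*1 X≈1)) (x*1 Y≈1)) ⟩
    1# + (x * y + y * z + x * z) ∎
    where
    x′ y′ z′ X Y Z : Carrier
    x′ = 1# - x
    y′ = 1# - y
    z′ = 1# - z
    X = x + x′
    Y = y + y′
    Z = z + z′

    complement : ∀ x → x + (1# - x) ≈ 1#
    complement x = trans (+-comm x (1# - x)) (x-z+z 1# x)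

    X≈1 = complement x
    Y≈1 = complement y
    Z≈1 = complement z

    x*1 : ∀ {x u} → u ≈ 1# → x * u ≈ x
    x*1 {x} u≈1 = trans (*-congˡ u≈1) (*-identityʳ x)

    x≈x*1*1 : ∀ x {u v} → u ≈ 1# → v ≈ 1# → x ≈ x * (u * v)
    x≈x*1*1 x u≈1 v≈1 = sym (x*1 (trans (x*1 v≈1) u≈1))

  -- Expanded, the left side is twice the difference between the sum of the three squares and the
  -- sum `P` of the three products; `squares≤1+products` bounds that difference by 1.
  square-triangle : ∀ {x y z} → 0# ≤ x × x ≤ 1# → 0# ≤ y × y ≤ 1# → 0# ≤ z × z ≤ 1# →
                    (x - y) ^ 2 + (y - z) ^ 2 + (x - z) ^ 2 ≤ two
  square-triangle {x} {y} {z} x∈ y∈ z∈ = +-cancelʳ-≤ (P + P) (begin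
    (x - y) ^ 2 + (y - z) ^ 2 + (x - z) ^ 2 + (P + P)
      ≈⟨ solve 6 (λ a b c p q r →
           a :+ b :+ c :+ ((p :+ q :+ r) :+ (p :+ q :+ r))
           := (a :+ (p :+ p)) :+ (b :+ (q :+ q)) :+ (c :+ (r :+ r)))
           refl _ _ _ (x * y) (y * z) (x * z) ⟩
    ((x - y) ^ 2 + (x * y + x * y)) + ((y - z) ^ 2 + (y * z + y * z))
      + ((x - z) ^ 2 + (x * z + x * z))
      ≈⟨ +-cong (+-cong (square-sub x y) (square-sub y z)) (square-sub x z) ⟩
    (x * x + y * y) + (y * y + z * z) + (x * x + z * z)
      ≈⟨ solve 3 (λ a b c → (a :+ b) :+ (b :+ c) :+ (a :+ c)
                     := (a :+ b :+ c) :+ (a :+ b :+ c)) refl _ _ _ ⟩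
    (x * x + y * y + z * z) + (x * x + y * y + z * z)
      ≤⟨ +-mono-≤ S≤1+P S≤1+P ⟩
    (1# + P) + (1# + P)
      ≈⟨ solve 2 (λ i p → (i :+ p) :+ (i :+ p) := (i :+ i) :+ (p :+ p)) refl 1# P ⟩
    two + (P + P) ∎)
    where
    P : Carrier
    P = x * y + y * z + x * z

    S≤1+P = squares≤1+products x∈ y∈ z∈

  -- (2/3)² < 1/2.
  double-square≤ : ∀ {q K} → 0# ≤ q → q + q + q ≤ K + K → two * (q * q) ≤ K * K
  double-square≤ {q} {K} 0≤q 3q≤2K = +-cancel-double-≤ (+-cancel-double-≤ (begin
    (t + t) + (t + t)          ≤⟨ 0≤⇒x≤x+y _ (0≤x*x q) ⟩
    (t + t) + (t + t) + q * q
      ≈⟨ solve 1 (λ q → let t = (con 1 :+ con 1) :* (q :* q) in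
           (t :+ t) :+ (t :+ t) :+ q :* q := (q :+ q :+ q) :* (q :+ q :+ q)) refl q ⟩
    (q + q + q) * (q + q + q)  ≤⟨ *-monoˡ-≤ 0≤3q 3q≤2K ⟩
    (K + K) * (q + q + q)      ≤⟨ *-monoʳ-≤ (≤-trans 0≤3q 3q≤2K) 3q≤2K ⟩
    (K + K) * (K + K)
      ≈⟨ solve 1 (λ K → (K :+ K) :* (K :+ K)
                    := (K :* K :+ K :* K) :+ (K :* K :+ K :* K)) refl K ⟩
    (K * K + K * K) + (K * K + K * K) ∎))
    where
    t : Carrier
    t = two * (q * q)

    0≤3q : 0# ≤ q + q + q
    0≤3q = +-nonNegative (+-nonNegative 0≤q 0≤q) 0≤q

  0≤two : 0# ≤ two
  0≤two = +-nonNegative 0≤1 0≤1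

  ^4≈ : ∀ x → x ^ 4 ≈ x ^ 2 * x ^ 2
  ^4≈ = solve 1 (λ x → x :* (x :* (x :* (x :* con 1)))
                   := x :* (x :* con 1) :* (x :* (x :* con 1))) refl

  module _ {e s : Carrier} (0≤e : 0# ≤ e) (0≤s : 0# ≤ s)
           (3e²≤2s² : e ^ 2 + e ^ 2 + e ^ 2 ≤ s ^ 2 + s ^ 2) where

    -- The assumption e² ≤ 2s²/3 gives 2e⁴ ≤ s⁴ by `double-square≤`. Each block of four factors thus
    -- gains a factor 2, and `m` blocks gain 2^m, which is at least `m`.
    fromNat*^≤ : ∀ m → fromNat m * e ^ (4 ℕ.* m) ≤ s ^ (4 ℕ.* m)
    fromNat*^≤ m = begin
      fromNat m * e ^ (4 ℕ.* m)   ≤⟨ *-monoˡ-≤ (0≤^ (4 ℕ.* m) 0≤e) (fromNat≤two^ m) ⟩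
      two ^ m * e ^ (4 ℕ.* m)     ≈⟨ *-congˡ (^-assocʳ e 4 m) ⟨
      two ^ m * (e ^ 4) ^ m       ≈⟨ ^-distrib-* two (e ^ 4) m ⟨
      (two * e ^ 4) ^ m           ≤⟨ ^-mono-≤ m (*-nonNegative 0≤two (0≤^ 4 0≤e)) (begin
        two * e ^ 4                  ≈⟨ *-congˡ (^4≈ e) ⟩
        two * (e ^ 2 * e ^ 2)        ≤⟨ double-square≤ (0≤^ 2 0≤e) 3e²≤2s² ⟩
        s ^ 2 * s ^ 2                ≈⟨ ^4≈ s ⟨
        s ^ 4                        ∎) ⟩
      (s ^ 4) ^ m                 ≈⟨ ^-assocʳ s 4 m ⟩
      s ^ (4 ℕ.* m)               ∎

    -- The exponent is spent in three portions: `M` factors gain 2n, two factors form e² ≤ 2D, and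
    -- the other `j` use e ≤ s. The 2 in 2D is why `M` is built from `n ℕ.+ n`.
    short-power≤ : ∀ n {M} → M ≡ 4 ℕ.* (n ℕ.+ n) → ∀ j {D} → e ≤ s → e ^ 2 ≤ D + D →
                   fromNat n * e ^ (M ℕ.+ (2 ℕ.+ j)) ≤ D * s ^ (M ℕ.+ j)
    short-power≤ n {M} ≡.refl j {D} e≤s e²≤2D = +-cancel-double-≤ (begin
      N * e ^ (M ℕ.+ (2 ℕ.+ j)) + N * e ^ (M ℕ.+ (2 ℕ.+ j))
        ≈⟨ distribʳ _ N N ⟨
      (N + N) * e ^ (M ℕ.+ (2 ℕ.+ j))
        ≈⟨ *-cong (sym (fromNat-+ n n)) (^-homo-* e M (2 ℕ.+ j)) ⟩
      fromNat (n ℕ.+ n) * (e ^ M * (e * (e * e ^ j)))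
        ≈⟨ solve 4 (λ a b e c → a :* (b :* (e :* (e :* c)))
                      := (a :* b) :* ((e :* (e :* con 1)) :* c)) refl _ _ e _ ⟩
      (fromNat (n ℕ.+ n) * e ^ M) * (e ^ 2 * e ^ j)
        ≤⟨ *-monoˡ-≤ (*-nonNegative (0≤^ 2 0≤e) (0≤^ j 0≤e)) (fromNat*^≤ (n ℕ.+ n)) ⟩
      s ^ M * (e ^ 2 * e ^ j)
        ≤⟨ *-monoʳ-≤ (0≤^ M 0≤s) (≤-trans (*-monoˡ-≤ (0≤^ j 0≤e) e²≤2D)
             (*-monoʳ-≤ (≤-trans (0≤^ 2 0≤e) e²≤2D) (^-mono-≤ j 0≤e e≤s))) ⟩
      s ^ M * ((D + D) * s ^ j)
        ≈⟨ solve 3 (λ a D b → a :* ((D :+ D) :* b)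
                      := D :* (a :* b) :+ D :* (a :* b)) refl _ D _ ⟩
      D * (s ^ M * s ^ j) + D * (s ^ M * s ^ j)
        ≈⟨ +-cong (*-congˡ (^-homo-* s M j)) (*-congˡ (^-homo-* s M j)) ⟨
      D * s ^ (M ℕ.+ j) + D * s ^ (M ℕ.+ j) ∎)
      where
      N : Carrier
      N = fromNat n

  ^-split-square : ∀ x m j → x ^ (m ℕ.+ (2 ℕ.+ j)) ≈ x ^ 2 * x ^ (m ℕ.+ j)
  ^-split-square x m j = begin-equality
    x ^ (m ℕ.+ (2 ℕ.+ j))      ≈⟨ ^-homo-* x m (2 ℕ.+ j) ⟩
    x ^ m * (x * (x * x ^ j))
      ≈⟨ solve 3 (λ a x b → a :* (x :* (x :* b)) := (x :* (x :* con 1)) :* (a :* b))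
           refl _ x _ ⟩
    x ^ 2 * (x ^ m * x ^ j)    ≈⟨ *-congˡ (^-homo-* x m j) ⟨
    x ^ 2 * x ^ (m ℕ.+ j)      ∎

-- Upper bound: a short tour through every point set.

∈⇒↭-last : ∀ {x y : A} {xs} → y ∈ x ∷ xs → ∃[ z ] ∃[ zs ] z ∷ zs ↭ x ∷ xs × end z zs ≡ y
∈⇒↭-last y∈ with ∈-∃++ y∈
... | []     , []     , ≡.refl = _ , [] , ↭-refl , ≡.refl
... | []     , z ∷ zs , ≡.refl = z , zs ++ [ _ ] , ++-comm (z ∷ zs) [ _ ] , end-++ z zs
... | z ∷ ys , zs     , ≡.refl =
  z , ys ++ zs ++ [ _ ] , prep z (++⁺ˡ ys (++-comm zs [ _ ])) ,
  ≡.trans (≡.cong (λ ws → end z ws) (≡.sym (++-assoc ys zs [ _ ]))) (end-++ z (ys ++ zs))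

module ShortTours {c ℓ : Level} (ℝ : CompleteOrderedField c ℓ) where
  open OrderedFieldProperties ℝ
  open HamiltonianCycles ℝ
  open Costs ℝ
  open Inequalities ℝ
  open Exp commutativeSemiring using (^-congʳ)
  open Sum +-commutativeMonoid using (∑-distrib-+; sum-cong-≋)
  open RingSolver commutativeSemiring using (solve; _:=_; _:+_; _:*_)
  open ≤-Reasoning poset

  sqDist : ∀ {k} → Point k → Point k → Carrier
  sqDist x y = sum (λ j → (x j - y j) ^ 2)

  distance² : ∀ {k} (x y : Point k) → distance x y ^ 2 ≈ sqDist x y
  distance² x y = proj₂ (root-spec 2 (0≤sum (λ j → (x j - y j) ^ 2) (λ j → 0≤^2 _)))

  sqDist-comm : ∀ {k} (x y : Point k) → sqDist x y ≈ sqDist y x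
  sqDist-comm x y = sum-cong-≋ (λ j → square-sub-comm (x j) (y j))

  0≤sqrt : ∀ k → 0# ≤ sqrt (fromNat k)
  0≤sqrt k = proj₁ (root-spec 2 (0≤fromNat k))

  sqrt² : ∀ k → sqrt (fromNat k) ^ 2 ≈ fromNat k
  sqrt² k = proj₂ (root-spec 2 (0≤fromNat k))

  minimal-pair : (f : A → A → Carrier) → ∀ x xs y ys →
                 ∃[ u ] ∃[ v ] u ∈ x ∷ xs × v ∈ y ∷ ys ×
                 (∀ {u′ v′} → u′ ∈ x ∷ xs → v′ ∈ y ∷ ys → f u v ≤ f u′ v′)
  minimal-pair {A = A} f x xs y ys = proj₁ uv , proj₂ uv , proj₁ uv∈ , proj₂ uv∈ ,
    λ u∈ v∈ → All.lookup (f[argmin]≤f[xs] (x , y) pairs) (∈-cartesianProduct⁺ u∈ v∈)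
    where
    open Extrema totalOrder using (argmin; argmin-all; f[argmin]≤f[xs])

    pairs : List (A × A)
    pairs = cartesianProduct (x ∷ xs) (y ∷ ys)

    g : A × A → Carrier
    g (u , v) = f u v

    uv : A × A
    -- The default `(x , y)` is itself a crossing pair, so the minimizer is one in any case.
    uv = argmin g (x , y) pairs

    uv∈ : proj₁ uv ∈ x ∷ xs × proj₂ uv ∈ y ∷ ys
    uv∈ = argmin-all g {P = λ (u , v) → u ∈ x ∷ xs × v ∈ y ∷ ys}
      (here ≡.refl , here ≡.refl)
      (All.tabulate (∈-cartesianProduct⁻ (x ∷ xs) (y ∷ ys)))

  module _ {n k : ℕ} (X : PointSet n k) where

    q : Fin n → Fin n → Carrier
    q a b = sqDist (point X a) (point X b)

    weight : Fin n → Fin n → Carrier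
    weight a b = distance (point X a) (point X b) ^ k

    Short : Fin n → Fin n → Set ℓ
    Short a b = q a b + q a b + q a b ≤ fromNat k + fromNat k

    q-sym : ∀ a b → q a b ≈ q b a
    q-sym a b = sqDist-comm (point X a) (point X b)

    0≤q : ∀ a b → 0# ≤ q a b
    0≤q a b = 0≤sum (λ j → (point X a j - point X b j) ^ 2) (λ j → 0≤^2 _)

    q≤k : ∀ a b → q a b ≤ fromNat k
    q≤k a b = ≤-respʳ (sum-const k 1#) (sum-mono-≤ _ (λ _ → 1#)
      (λ j → square≤1 (inCube X a j) (inCube X b j)))

    q-triangle : ∀ a b d → q a b + q b d + q a d ≤ fromNat k + fromNat k
    q-triangle a b d = begin
      q a b + q b d + q a d
        ≈⟨ +-congʳ (∑-distrib-+ {k} _ _) ⟨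
      sum {k} (λ j → (x j - y j) ^ 2 + (y j - z j) ^ 2) + q a d
        ≈⟨ ∑-distrib-+ {k} _ _ ⟨
      sum {k} (λ j → (x j - y j) ^ 2 + (y j - z j) ^ 2 + (x j - z j) ^ 2)
        ≤⟨ sum-mono-≤ {k} _ (λ _ → two)
             (λ j → square-triangle (inCube X a j) (inCube X b j) (inCube X d j)) ⟩
      sum {k} (λ _ → two)
        ≈⟨ sum-const-* k two ⟩
      fromNat k * two
        ≈⟨ trans (*-comm _ two) (two* (fromNat k)) ⟩
      fromNat k + fromNat k ∎
      where
      x = point X a
      y = point X b
      z = point X d

    short? : ∀ a b → Dec (Short a b)
    short? a b = _ ≤? _

    short-sym : ∀ {a b} → Short a b → Short b a
    short-sym {a} {b} = ≤-respˡ (+-cong (+-cong (q-sym a b) (q-sym a b)) (q-sym a b))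

    -- The smallest of the three squared distances, taken three times, is at most their sum, which
    -- `q-triangle` bounds by 2k.
    no-long-triangle : ∀ a b d → Short a b ⊎ Short b d ⊎ Short a d
    no-long-triangle a b d
      with total (q a b) (q b d) | total (q a b) (q a d) | total (q b d) (q a d)
    ... | inj₁ ab≤bd | inj₁ ab≤ad | _ =
      inj₁ (≤-trans (+-mono-≤ (+-mono-≤ ≤-refl ab≤bd) ab≤ad) (q-triangle a b d))
    ... | inj₂ bd≤ab | _ | inj₁ bd≤ad =
      inj₂ (inj₁ (≤-trans (+-mono-≤ (+-mono-≤ bd≤ab ≤-refl) bd≤ad) (q-triangle a b d)))
    ... | _ | inj₂ ad≤ab | inj₂ ad≤bd =
      inj₂ (inj₂ (≤-trans (+-mono-≤ (+-mono-≤ ad≤ab ad≤bd) ≤-refl) (q-triangle a b d)))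
    -- In the two remaining cases the comparisons run in a circle, so all three values agree and
    -- `a b` can serve as the smallest.
    ... | inj₁ ab≤bd | inj₂ ad≤ab | inj₁ bd≤ad =
      inj₁ (≤-trans (+-mono-≤ (+-mono-≤ ≤-refl ab≤bd) (≤-trans ab≤bd bd≤ad)) (q-triangle a b d))
    ... | inj₂ bd≤ab | inj₁ ab≤ad | inj₂ ad≤bd =
      inj₁ (≤-trans (+-mono-≤ (+-mono-≤ ≤-refl (≤-trans ab≤ad ad≤bd)) ab≤ad) (q-triangle a b d))

    distance≤sqrt : ∀ a b → distance (point X a) (point X b) ≤ sqrt (fromNat k)
    distance≤sqrt a b = ^-cancel-≤ 2 (0≤sqrt k)
      (≤-respˡ (sym (distance² (point X a) (point X b))) (≤-respʳ (sym (sqrt² k)) (q≤k a b)))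

    weight≤ : ∀ a b → weight a b ≤ sqrt (fromNat k) ^ k
    weight≤ a b = ^-mono-≤ k (0≤distance (point X a) (point X b)) (distance≤sqrt a b)

  module _ {n k M j : ℕ} (M≡ : M ≡ 4 ℕ.* (suc n ℕ.+ suc n)) (k≡ : k ≡ M ℕ.+ (2 ℕ.+ j))
           (X : PointSet (suc n) k) where

    open Arrangements (Short X) (short? X) (λ {a} → short-sym X {a}) (no-long-triangle X)

    private
      N K s T : Carrier
      N = fromNat (suc n)
      K = fromNat k
      s = sqrt K
      -- As k is M + 2 + j, this is s^(k-2). Costs are measured as squared lengths times `T`, with K
      -- T equal to s^k, so that savings in squared length can be added up.
      T = s ^ (M ℕ.+ j)

      0≤T : 0# ≤ T
      0≤T = 0≤^ (M ℕ.+ j) (0≤sqrt k)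

      w : Fin (suc n) → Fin (suc n) → Carrier
      w = weight X

      ^-split : ∀ x → x ^ k ≈ x ^ 2 * x ^ (M ℕ.+ j)
      ^-split x = trans (^-congʳ x k≡) (^-split-square x M j)

      K*T≈s^k : K * T ≈ s ^ k
      K*T≈s^k = sym (trans (^-split s) (*-congʳ (sqrt² k)))

    ShortTour : Set ℓ
    ShortTour = ∃[ x ] ∃[ xs ] x ∷ xs ↭ allFin (suc n) × tourCost w x xs ≤ s ^ k + s ^ k

    weight≤q*T : ∀ a b → w a b ≤ q X a b * T
    weight≤q*T a b = begin
      w a b         ≈⟨ ^-split e ⟩
      e ^ 2 * e ^ (M ℕ.+ j)
        ≈⟨ *-congʳ (distance² (point X a) (point X b)) ⟩
      q X a b * e ^ (M ℕ.+ j)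
        ≤⟨ *-monoʳ-≤ (0≤q X a b) (^-mono-≤ (M ℕ.+ j)
             (0≤distance (point X a) (point X b)) (distance≤sqrt X a b)) ⟩
      q X a b * T   ∎
      where
      e : Carrier
      e = distance (point X a) (point X b)

    short-weight≤ : ∀ {D a b} → Short X a b → q X a b ≤ D + D → N * w a b ≤ D * T
    short-weight≤ {D} {a} {b} short q≤2D =
      ≤-respˡ (*-congˡ (^-congʳ _ (≡.sym k≡)))
        (short-power≤ (0≤distance (point X a) (point X b)) (0≤sqrt k)
          (≤-respˡ (sym (+-cong (+-cong e² e²) e²))
            (≤-respʳ (sym (+-cong (sqrt² k) (sqrt² k))) short))
          (suc n) M≡ j (distance≤sqrt X a b) (≤-respˡ (sym e²) q≤2D))
      where
      e² = distance² (point X a) (point X b)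

    cancel-N : ∀ m {x b} → m ℕ.≤ suc n → 0# ≤ b → N * x ≤ fromNat m * b → x ≤ b
    cancel-N m {x} {b} m≤n 0≤b p = *-cancelˡ-≤ (0≤fromNat (suc n)) (fromNat-≉0 (suc n))
      (≤-trans p (*-monoˡ-≤ 0≤b (fromNat-mono-≤ m≤n)))

    length-vertices : ∀ {x xs} → x ∷ xs ↭ allFin (suc n) → suc (length xs) ≡ suc n
    length-vertices p = ≡.trans (↭-length p) (length-tabulate {n = suc n} (λ i → i))

    -- The short-edge bound is used with D = K: all path edges together cost at most K T = s^k, and
    -- the arbitrary closing edge costs at most another s^k.
    path-tour≤ : ∀ {x xs} → x ∷ xs ↭ allFin (suc n) → Linked (Short X) (x ∷ xs) →
                 tourCost w x xs ≤ s ^ k + s ^ k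
    path-tour≤ {x} {xs} p l = +-mono-≤ (≤-respʳ K*T≈s^k cost≤) (weight≤ X (end x xs) x)
      where
      cost≤ : cost w x xs ≤ K * T
      cost≤ = cancel-N (length xs)
        (ℕ.≤-trans (ℕ.n≤1+n _) (ℕ.≤-reflexive (length-vertices p)))
        (*-nonNegative (0≤fromNat k) 0≤T)
        (cost-≤ w (λ {a} {b} short → short-weight≤ {K} {a} {b} short
          (≤-trans (q≤k X a b) (0≤⇒x≤x+y K (0≤fromNat k)))) l)

    -- The closing edge b a is the longest possible crossing, and its deficit
    -- D = k - |a - b|² bounds the squares of all distances inside the two parts.
    separated-tour≤ : ∀ {a as z zs} → a ∷ as ++ z ∷ zs ↭ allFin (suc n) →
      (∀ {u v} → u ∈ a ∷ as → v ∈ z ∷ zs → ¬ Short X u v) →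
      end z zs ∈ z ∷ zs →
      (∀ {u v} → u ∈ a ∷ as → v ∈ z ∷ zs → q X a (end z zs) ≤ q X u v) →
      tourCost w a (as ++ z ∷ zs) ≤ s ^ k + s ^ k
    separated-tour≤ {a} {as} {z} {zs} p sep b∈ minimal = begin
      cost w a (as ++ z ∷ zs) + w (end a (as ++ z ∷ zs)) a
        ≈⟨ +-cong (cost-++ w a as z zs) (reflexive (≡.cong (λ e → w e a) (end-++ a as))) ⟩
      (cost w a as + (w (end a as) z + cost w z zs)) + w b a
        -- The first crossing edge is bounded crudely by s^k. The closing one keeps its squared
        -- length `q*`, so that the D T of the inner edges completes it to K T.
        ≤⟨ +-mono-≤ (+-monoʳ-≤ _ (+-monoˡ-≤ _ (weight≤ X (end a as) z))) (weight≤q*T b a) ⟩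
      (cost w a as + (s ^ k + cost w z zs)) + q X b a * T
        ≈⟨ +-congˡ (*-congʳ (q-sym X b a)) ⟩
      (cost w a as + (s ^ k + cost w z zs)) + q* * T
        ≈⟨ solve 4 (λ c s d t → (c :+ (s :+ d)) :+ t := s :+ ((c :+ d) :+ t)) refl
             (cost w a as) (s ^ k) (cost w z zs) (q* * T) ⟩
      s ^ k + ((cost w a as + cost w z zs) + q* * T)
        ≤⟨ +-monoʳ-≤ _ (+-monoˡ-≤ _ inner≤) ⟩
      s ^ k + (D * T + q* * T)
        ≈⟨ +-congˡ (distribʳ T D q*) ⟨
      s ^ k + (D + q*) * T
        ≈⟨ +-congˡ (*-congʳ (x-z+z K q*)) ⟩
      s ^ k + K * T
        ≈⟨ +-congˡ K*T≈s^k ⟩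
      s ^ k + s ^ k ∎
      where
      b : Fin (suc n)
      b = end z zs

      q* D : Carrier
      q* = q X a b
      D = K - q*

      0≤D : 0# ≤ D
      0≤D = ≤⇒0≤- (q≤k X a b)

      Inner : Fin (suc n) → Fin (suc n) → Set ℓ
      Inner u v = Short X u v × q X u v ≤ D + D

      -- The apex `y` lies in the other part, so two sides of the triangle have squared length at
      -- least `q*`. Of the total 2K this leaves 2(K - q*) for the third side.
      close : ∀ {u v y} → q* ≤ q X v y → q* ≤ q X u y → q X u v ≤ D + D
      close {u} {v} {y} vy uy = +-cancelʳ-≤ (q* + q*) (begin
        q X u v + (q* + q*)            ≤⟨ +-monoʳ-≤ _ (+-mono-≤ vy uy) ⟩
        q X u v + (q X v y + q X u y)  ≈⟨ +-assoc _ _ _ ⟨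
        q X u v + q X v y + q X u y    ≤⟨ q-triangle X u v y ⟩
        K + K                          ≈⟨ +-cong (x-z+z K q*) (x-z+z K q*) ⟨
        (D + q*) + (D + q*)
          ≈⟨ solve 2 (λ d q → (d :+ q) :+ (d :+ q) := (d :+ d) :+ (q :+ q)) refl D q* ⟩
        (D + D) + (q* + q*)            ∎)

      linkedᵃ : Linked Inner (a ∷ as)
      linkedᵃ = clique-linked (a ∷ as) λ {u} {v} u∈ v∈ →
        clique (λ u∈ → sep u∈ b∈) u∈ v∈ ,
        close {u} {v} {b} (minimal v∈ b∈) (minimal u∈ b∈)

      linkedᵇ : Linked Inner (z ∷ zs)
      linkedᵇ = clique-linked (z ∷ zs) λ {u} {v} u∈ v∈ →
        clique {y = a} (λ {u} u∈ short → sep (here ≡.refl) u∈ (short-sym X {u} {a} short)) u∈ v∈ ,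
        close {u} {v} {a} (≤-respʳ (q-sym X a v) (minimal (here ≡.refl) v∈))
          (≤-respʳ (q-sym X a u) (minimal (here ≡.refl) u∈))

      inner-bound : ∀ {u v} → Inner u v → N * w u v ≤ D * T
      inner-bound {u} {v} (short , q≤2D) = short-weight≤ {D} {u} {v} short q≤2D

      inner≤ : cost w a as + cost w z zs ≤ D * T
      inner≤ = cancel-N (length as ℕ.+ length zs) lengths≤ (*-nonNegative 0≤D 0≤T) (begin
        N * (cost w a as + cost w z zs)      ≈⟨ distribˡ N _ _ ⟩
        N * cost w a as + N * cost w z zs
          ≤⟨ +-mono-≤ (cost-≤ w inner-bound linkedᵃ) (cost-≤ w inner-bound linkedᵇ) ⟩
        fromNat (length as) * (D * T) + fromNat (length zs) * (D * T)
          ≈⟨ distribʳ (D * T) _ _ ⟨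
        (fromNat (length as) + fromNat (length zs)) * (D * T)
          ≈⟨ *-congʳ (fromNat-+ (length as) (length zs)) ⟨
        fromNat (length as ℕ.+ length zs) * (D * T) ∎)
        where
        lengths≤ : length as ℕ.+ length zs ℕ.≤ suc n
        lengths≤ = ℕ.≤-trans
          (ℕ.≤-trans (ℕ.+-monoʳ-≤ (length as) (ℕ.n≤1+n (length zs)))
            (ℕ.≤-reflexive (≡.sym (length-++ as))))
          (ℕ.≤-trans (ℕ.n≤1+n _) (ℕ.≤-reflexive (length-vertices p)))

    -- Within the parts the order is free, so the closest crossing pair can be placed at the two
    -- ends of the list, where it becomes the closing edge.
    short-separated-tour : ∀ {x xs y ys} → x ∷ xs ++ y ∷ ys ↭ allFin (suc n) →
      (∀ {u v} → u ∈ x ∷ xs → v ∈ y ∷ ys → ¬ Short X u v) →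
      (∃[ a ] ∃[ b ] a ∈ x ∷ xs × b ∈ y ∷ ys ×
        (∀ {u v} → u ∈ x ∷ xs → v ∈ y ∷ ys → q X a b ≤ q X u v)) →
      ShortTour
    short-separated-tour p sep (a , b , a∈ , b∈ , minimal) with ∈⇒↭-head a∈ | ∈⇒↭-last b∈
    ... | as , p₁ | z , zs , p₂ , ≡.refl =
      a , as ++ z ∷ zs , ↭-trans (++⁺ p₁ p₂) p ,
      separated-tour≤ (↭-trans (++⁺ p₁ p₂) p)
        (λ u∈ v∈ → sep (∈-resp-↭ p₁ u∈) (∈-resp-↭ p₂ v∈))
        (∈-resp-↭ (↭-sym p₂) b∈)
        (λ u∈ v∈ → minimal (∈-resp-↭ p₁ u∈) (∈-resp-↭ p₂ v∈))

    short-arranged-tour : Arrangement (allFin (suc n)) → ShortTour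
    short-arranged-tour (path {x} {xs} p l) = x , xs , p , path-tour≤ p l
    short-arranged-tour (separated {x} {xs} {y} {ys} p sep) =
      short-separated-tour p sep (minimal-pair (q X) x xs y ys)

    short-cycle : Σ (HamiltonianCycle (suc n)) λ H → cycleSum X H ≤ s ^ k + s ^ k
    short-cycle =
      -- `zero ∷ tabulate suc` is `allFin (suc n)` by computation.
      let x , xs , p , tour≤ = short-arranged-tour (arrange zero (tabulate suc))
          H , sum≈           = cycle-from-list x xs p
      in H , ≤-respˡ (sym (sum≈ w)) tour≤

-- Matching bounds for the supremum.

module Bounds {c ℓ : Level} (ℝ : CompleteOrderedField c ℓ) where
  open OrderedFieldProperties ℝ
  open HamiltonianCycles ℝ
  open Costs ℝ
  open Inequalities ℝ
  open ShortTours ℝ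
  open Exp commutativeSemiring using (^-distrib-*)
  open RingSolver commutativeSemiring using (solve; _:=_; _:+_; _:*_)
  open ≤-Reasoning poset

  0≤sCycle : ∀ {n k} .{{_ : NonZero k}} (X : PointSet n k) H → 0# ≤ sCycle X H
  0≤sCycle {k = k} X H = proj₁ (root-spec k (0≤cycleSum X H))

  sCycle^k : ∀ {n k} .{{_ : NonZero k}} (X : PointSet n k) H → sCycle X H ^ k ≈ cycleSum X H
  sCycle^k {k = k} X H = proj₂ (root-spec k (0≤cycleSum X H))

  module _ (k : ℕ) .{{_ : NonZero k}} where

    extremal : Carrier
    extremal = root k (fromNat 2) * sqrt (fromNat k)

    0≤extremal : 0# ≤ extremal
    0≤extremal = *-nonNegative (proj₁ (root-spec k (0≤fromNat 2))) (0≤sqrt k)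

    -- The scale `t` serves both bounds: t = 1 for the upper one, t = 1 - δ for the clustered
    -- configuration.
    scaled-extremal^k : ∀ t → (t * extremal) ^ k ≈
      (t * sqrt (fromNat k)) ^ k + (t * sqrt (fromNat k)) ^ k
    scaled-extremal^k t = begin-equality
      (t * (r * s)) ^ k
        ≈⟨ ^-congˡ k (solve 3 (λ t r s → t :* (r :* s) := r :* (t :* s)) refl t r s) ⟩
      (r * (t * s)) ^ k    ≈⟨ ^-distrib-* r (t * s) k ⟩
      r ^ k * (t * s) ^ k  ≈⟨ *-congʳ (trans (proj₂ (root-spec k (0≤fromNat 2))) fromNat-2) ⟩
      two * (t * s) ^ k    ≈⟨ two* _ ⟩
      (t * s) ^ k + (t * s) ^ k ∎
      where
      r = root k (fromNat 2)
      s = sqrt (fromNat k)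

    extremal^k : extremal ^ k ≈ sqrt (fromNat k) ^ k + sqrt (fromNat k) ^ k
    extremal^k = begin-equality
      extremal ^ k                ≈⟨ ^-congˡ k (*-identityˡ extremal) ⟨
      (1# * extremal) ^ k         ≈⟨ scaled-extremal^k 1# ⟩
      (1# * s) ^ k + (1# * s) ^ k
        ≈⟨ +-cong (^-congˡ k (*-identityˡ s)) (^-congˡ k (*-identityˡ s)) ⟩
      s ^ k + s ^ k               ∎
      where
      s = sqrt (fromNat k)

    extremal-≉0 : extremal ≉ 0#
    extremal-≉0 = *-≉0
      (λ r≈0 → fromNat-≉0 2 (trans (sym (proj₂ (root-spec k (0≤fromNat 2))))
        (trans (^-congˡ k r≈0) (0^k≈0 k))))
      (λ s≈0 → fromNat-≉0 k (trans (sym (sqrt² k)) (trans (^-congˡ 2 s≈0) (0^k≈0 2))))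

    sHC≤extremal : ∀ {n M j} → M ≡ 4 ℕ.* (suc n ℕ.+ suc n) → k ≡ M ℕ.+ (2 ℕ.+ j) →
                   sHC (suc n) k ≤ extremal
    sHC≤extremal {n} M≡ k≡ = proj₂ (sHC-supremum (suc n) k) extremal λ v (X , v≈) →
      let H , sum≤ = short-cycle M≡ k≡ X in
      ≤-trans (≤-respˡ (sym v≈) (proj₂ (sHCof-minimum X) H))
        (^-cancel-≤ k 0≤extremal
          (≤-respˡ (sym (sCycle^k X H)) (≤-respʳ (sym extremal^k) sum≤)))

  -- One point at the corner (1,…,1), all others on the diagonal within δ of the origin.
  module Clustered (n : ℕ) (k : ℕ) .{{_ : NonZero k}} (δ : Carrier)
                   (0<δ : 0# < δ) (δ≤1 : δ ≤ 1#) (δ≉1 : δ ≉ 1#) where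

    -- A supply of distinct numbers in [0,1], namely the reciprocals 1/(a+1). Scaled by `δ` they
    -- form the cluster; δ ≉ 1 keeps it away from the corner.
    U : PointSet (suc (suc n)) 1
    U = pointSet (suc (suc n)) 1

    coordinate : Fin (suc (suc n)) → Carrier
    coordinate zero    = 1#
    coordinate (suc a) = δ * point U (suc a) zero

    0≤coordinate : ∀ a → 0# ≤ coordinate a
    0≤coordinate zero    = 0≤1
    0≤coordinate (suc a) = *-nonNegative (proj₁ 0<δ) (proj₁ (inCube U (suc a) zero))

    coordinate≤δ : ∀ a → coordinate (suc a) ≤ δ
    coordinate≤δ a =
      ≤-respʳ (*-identityʳ δ) (*-monoʳ-≤ (proj₁ 0<δ) (proj₂ (inCube U (suc a) zero)))

    coordinate≤1 : ∀ a → coordinate a ≤ 1#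
    coordinate≤1 zero    = ≤-refl
    coordinate≤1 (suc a) = ≤-trans (coordinate≤δ a) δ≤1

    1≉coordinate : ∀ a → 1# ≉ coordinate (suc a)
    1≉coordinate a eq = δ≉1 (antisym δ≤1 (≤-respˡ (sym eq) (coordinate≤δ a)))

    coordinate-injective : ∀ a b → coordinate a ≈ coordinate b → a ≡ b
    coordinate-injective zero    zero    _  = ≡.refl
    coordinate-injective zero    (suc b) eq = contradiction eq (1≉coordinate b)
    coordinate-injective (suc a) zero    eq = contradiction (sym eq) (1≉coordinate a)
    coordinate-injective (suc a) (suc b) eq = distinct U (suc a) (suc b)
      λ { zero → antisym (cancel (≤-reflexive eq)) (cancel (≤-reflexive (sym eq))) }
      where
      cancel : ∀ {x y} → δ * x ≤ δ * y → x ≤ y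
      cancel = *-cancelˡ-≤ (proj₁ 0<δ) (λ δ≈0 → proj₂ 0<δ (sym δ≈0))

    diagonal-injective : ∀ k .{{_ : NonZero k}} a b →
                         ((j : Fin k) → coordinate a ≈ coordinate b) → a ≡ b
    diagonal-injective (suc _) a b eq = coordinate-injective a b (eq zero)

    X : PointSet (suc (suc n)) k
    X = record
      { point    = λ a _ → coordinate a
      ; distinct = diagonal-injective k
      ; inCube   = λ a _ → 0≤coordinate a , coordinate≤1 a
      }

    -- The distance from (1,...,1) to (δ,...,δ), hence a lower bound for the distance from the
    -- corner to any point of the cluster.
    far : Carrier
    far = (1# - δ) * sqrt (fromNat k)

    0≤1-δ : 0# ≤ 1# - δ
    0≤1-δ = ≤⇒0≤- δ≤1

    0≤far : 0# ≤ far
    0≤far = *-nonNegative 0≤1-δ (0≤sqrt k)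

    far²≤ : ∀ b → far ^ 2 ≤ sqDist (point X zero) (point X (suc b))
    far²≤ b = begin
      ((1# - δ) * sqrt (fromNat k)) ^ 2       ≈⟨ ^-distrib-* _ _ 2 ⟩
      (1# - δ) ^ 2 * sqrt (fromNat k) ^ 2     ≈⟨ *-congˡ (sqrt² k) ⟩
      (1# - δ) ^ 2 * fromNat k                ≈⟨ *-comm _ _ ⟩
      fromNat k * (1# - δ) ^ 2                ≈⟨ sum-const-* k _ ⟨
      sum {k} (λ _ → (1# - δ) ^ 2)
        ≤⟨ sum-mono-≤ {k} _ _ (λ _ → ^-mono-≤ 2 0≤1-δ (+-monoʳ-≤ 1# (neg-≤ (coordinate≤δ b)))) ⟩
      sum {k} (λ _ → (1# - coordinate (suc b)) ^ 2) ∎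
      where
      neg-≤ : ∀ {x y} → x ≤ y → - y ≤ - x
      neg-≤ {x} {y} x≤y = +-cancelʳ-≤ x (+-cancelʳ-≤ y (begin
        (- y + x) + y  ≈⟨ solve 3 (λ m x y → (m :+ x) :+ y := x :+ (m :+ y)) refl (- y) x y ⟩
        x + (- y + y)  ≈⟨ trans (+-congˡ (-‿inverseˡ y)) (+-identityʳ x) ⟩
        x              ≤⟨ x≤y ⟩
        y              ≈⟨ trans (+-congʳ (-‿inverseˡ x)) (+-identityˡ y) ⟨
        (- x + x) + y  ∎))

    far≤ : ∀ {a b} → far ^ 2 ≤ sqDist (point X a) (point X b) →
           far ≤ distance (point X a) (point X b)
    far≤ {a} {b} p = ^-cancel-≤ 2 (0≤distance (point X a) (point X b))
      (≤-respʳ (sym (distance² (point X a) (point X b))) p)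

    far≤from : ∀ {a b} → a ≡ zero → b ≢ zero → far ≤ distance (point X a) (point X b)
    far≤from {b = zero}  ≡.refl b≢0 = contradiction ≡.refl b≢0
    far≤from {b = suc b} ≡.refl b≢0 = far≤ {zero} {suc b} (far²≤ b)

    far≤to : ∀ {a b} → a ≢ zero → b ≡ zero → far ≤ distance (point X a) (point X b)
    far≤to {zero}  a≢0 ≡.refl = contradiction ≡.refl a≢0
    far≤to {suc a} a≢0 ≡.refl = far≤ {suc a} {zero}
      (≤-respʳ (sqDist-comm (point X zero) (point X (suc a))) (far²≤ a))

    -- The corner is visited at position `i`; the edges indexed by `i` and `prev i` leave and enter
    -- it. These indices differ even for two points, where both edges are the same segment, so two
    -- terms are always available.
    far-twice≤cycleSum : ∀ H → far ^ k + far ^ k ≤ cycleSum X H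
    far-twice≤cycleSum H = begin
      far ^ k + far ^ k
        ≤⟨ +-mono-≤ (^-mono-≤ k 0≤far (far≤from Hi≡0 (only-i next-i≢i)))
             (^-mono-≤ k 0≤far (far≤to (only-i (λ eq → next-i≢i (next-id eq)))
               (≡.trans (≡.cong (H ⟨$⟩ʳ_) (next-prev i)) Hi≡0))) ⟩
      edge X H i ^ k + edge X H (prev i) ^ k
        ≤⟨ two-terms≤sum (λ i → edge X H i ^ k) (λ i → 0≤^ k (0≤edge X H i))
             (λ eq → next-i≢i (next-id (≡.sym eq))) ⟩
      cycleSum X H ∎
      where
      i : Fin (suc (suc n))
      i = H ⟨$⟩ˡ zero

      Hi≡0 : H ⟨$⟩ʳ i ≡ zero
      Hi≡0 = Perm.inverseʳ H

      next-i≢i : next i ≢ i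
      next-i≢i = next≢id i

      next-id : prev i ≡ i → next i ≡ i
      next-id eq = ≡.trans (≡.cong next (≡.sym eq)) (next-prev i)

      only-i : ∀ {l} → l ≢ i → H ⟨$⟩ʳ l ≢ zero
      only-i l≢i Hl≡0 = l≢i (≡.trans (≡.sym (Perm.inverseˡ H)) (≡.cong (H ⟨$⟩ˡ_) Hl≡0))

    scaled-extremal≤sHC : (1# - δ) * extremal k ≤ sHC (suc (suc n)) k
    scaled-extremal≤sHC = ≤-trans
      (^-cancel-≤ k (0≤sCycle X H)
        (≤-respˡ (sym (scaled-extremal^k k (1# - δ)))
          (≤-respʳ (sym (sCycle^k X H)) (far-twice≤cycleSum H))))
      (proj₁ (sHC-supremum (suc (suc n)) k) (sHCof X) (X , refl))
      where
      H : HamiltonianCycle (suc (suc n))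
      H = proj₁ (shortest-exists X)

  0≤sHC : ∀ n k .{{_ : NonZero k}} → 0# ≤ sHC n k
  0≤sHC n k = ≤-trans (0≤sCycle X (proj₁ (shortest-exists X)))
    (proj₁ (sHC-supremum n k) (sHCof X) (X , refl))
    where
    X : PointSet n k
    X = pointSet n k

  -- The clustered sets give (1 - δ)V ≤ S for arbitrarily small δ, an error of δ V that
  -- `≤-by-approximation` removes.
  extremal≤sHC : ∀ n k .{{_ : NonZero k}} → extremal k ≤ sHC (suc (suc n)) k
  extremal≤sHC n k = ≤-by-approximation (0≤extremal k) approx
    where
    V S : Carrier
    V = extremal k
    S = sHC (suc (suc n)) k

    approx′ : ∀ δ → 0# < δ → δ ≤ 1# → Dec (δ ≈ 1#) → V ≤ S + δ * V
    -- δ = 1 is excluded from the construction, but then δ V is V and 0 ≤ S suffices.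
    approx′ δ _ _ (yes δ≈1) = begin
      V          ≤⟨ 0≤⇒x≤y+x V (0≤sHC (suc (suc n)) k) ⟩
      S + V      ≈⟨ +-congˡ (trans (*-congʳ δ≈1) (*-identityˡ V)) ⟨
      S + δ * V  ∎
    approx′ δ 0<δ δ≤1 (no δ≉1) = begin
      V                       ≈⟨ *-identityˡ V ⟨
      1# * V                  ≈⟨ *-congʳ (x-z+z 1# δ) ⟨
      ((1# - δ) + δ) * V      ≈⟨ distribʳ V _ _ ⟩
      (1# - δ) * V + δ * V    ≤⟨ +-monoˡ-≤ _ (Clustered.scaled-extremal≤sHC n k δ 0<δ δ≤1 δ≉1) ⟩
      S + δ * V               ∎

    approx : ∀ δ → 0# < δ → δ ≤ 1# → V ≤ S + δ * V
    approx δ 0<δ δ≤1 = approx′ δ 0<δ δ≤1 (δ ≟ 1#)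

  -- From eventual equality to a vanishing relative error.

  factor-out : ∀ S {V u} → V * u ≈ 1# → S ≈ V * (1# + (S * u - 1#))
  factor-out S {V} {u} Vu≈1 = begin-equality
    S                           ≈⟨ *-identityʳ S ⟨
    S * 1#                      ≈⟨ *-congˡ Vu≈1 ⟨
    S * (V * u)                 ≈⟨ solve 3 (λ s v u → s :* (v :* u) := v :* (s :* u)) refl S V u ⟩
    V * (S * u)                 ≈⟨ *-congˡ (trans (+-comm 1# _) (x-z+z (S * u) 1#)) ⟨
    V * (1# + (S * u - 1#))     ∎

  factor-out≈0 : ∀ {S V u} → V * u ≈ 1# → S ≈ V → S * u - 1# ≈ 0#
  factor-out≈0 Vu≈1 S≈V = trans (+-congʳ (trans (*-congʳ S≈V) Vu≈1)) (-‿inverseʳ 1#)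

  sHC≈extremal : ∀ n k .{{_ : NonZero k}} → 4 ℕ.* (suc (suc n) ℕ.+ suc (suc n)) ℕ.+ 2 ≤ℕ k →
                 sHC (suc (suc n)) k ≈ extremal k
  sHC≈extremal n k M≤k = antisym
    (sHC≤extremal k {M = M} ≡.refl
      -- The spare exponent `j` is whatever `k` has beyond M + 2.
      (≡.trans (≡.sym (ℕ.m+[n∸m]≡n M≤k)) (ℕ.+-assoc M 2 _)))
    (extremal≤sHC n k)
    where
    M : ℕ
    M = 4 ℕ.* (suc (suc n) ℕ.+ suc (suc n))

  eventually-zero⇒tendsToZero : ∀ {e} N → (∀ m → N ≤ℕ m → e m ≈ 0#) → TendsToZero e
  eventually-zero⇒tendsToZero N e≈0 ε (0≤ε , 0≉ε) = N , λ m N≤m →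
    ( ≤-respʳ (sym (e≈0 m N≤m)) (≤-respˡ (+-identityˡ (- ε))
        (≤-respʳ (-‿inverseʳ ε) (+-monoˡ-≤ (- ε) 0≤ε)))
    , λ -ε≈e → 0≉ε (sym (trans (sym (-‿involutive ε))
        (trans (-‿cong (trans -ε≈e (e≈0 m N≤m))) -0#≈0#))) ) ,
    ( ≤-respˡ (sym (e≈0 m N≤m)) 0≤ε
    , λ e≈ε → 0≉ε (trans (sym (e≈0 m N≤m)) e≈ε) )

  -- The error is S/V - 1 for every positive `k`, so the equation holds below the threshold `N` as
  -- well, while beyond it the error is exactly zero.
  eventually-equal⇒relativeError :
    (S V : (k : ℕ) .{{_ : NonZero k}} → Carrier) →
    (∀ k .{{_ : NonZero k}} → V k ≉ 0#) →
    ∀ N → (∀ k .{{_ : NonZero k}} → N ≤ℕ k → S k ≈ V k) →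
    ∃[ o ] (TendsToZero o × (∀ (k : ℕ) .{{_ : NonZero k}} → S k ≈ V k * (1# + o k)))
  eventually-equal⇒relativeError S V V≉0 N S≈V =
    o , eventually-zero⇒tendsToZero N o≈0 , S≈V[1+o]
    where
    V⁻¹ : ∀ k .{{_ : NonZero k}} → ∃[ u ] V k * u ≈ 1#
    V⁻¹ k = inverse (V k) (V≉0 k)

    o : ℕ → Carrier
    -- A filler value: there is no zeroth root, and the equation is claimed for nonzero `k` only.
    o zero      = 0#
    o k@(suc _) = S k * proj₁ (V⁻¹ k) - 1#

    o≈0 : ∀ k → N ≤ℕ k → o k ≈ 0#
    o≈0 zero      _   = refl
    o≈0 k@(suc _) N≤k = factor-out≈0 (proj₂ (V⁻¹ k)) (S≈V k N≤k)

    S≈V[1+o] : ∀ k .{{_ : NonZero k}} → S k ≈ V k * (1# + o k)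
    S≈V[1+o] zero {{k≢0}} = contradiction ≡.refl (ℕ.≢-nonZero⁻¹ 0 {{k≢0}})
    S≈V[1+o] k@(suc _)    = factor-out (S k) (proj₂ (V⁻¹ k))

theorem1p7 : ∀ {c ℓ : Level} (ℝ : CompleteOrderedField c ℓ) →
    let open OrderedFieldProperties ℝ
        open HamiltonianCycles ℝ
    in ∀ (n : ℕ) → 2 ≤ℕ n →
       ∃[ o ] (TendsToZero o ×
               (∀ (k : ℕ) .{{_ : NonZero k}} →
                  sHC n k ≈ root k (fromNat 2) * sqrt (fromNat k) * (1# + o k)))
theorem1p7 ℝ (suc (suc n)) (ℕ.s≤s (ℕ.s≤s ℕ.z≤n)) =
  eventually-equal⇒relativeError (λ k → sHC (suc (suc n)) k) (λ k → extremal k)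
    (λ k → extremal-≉0 k) _ (λ k → sHC≈extremal n k)
  where
  open OrderedFieldProperties ℝ
  open HamiltonianCycles ℝ
  open Bounds ℝ
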